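{- Let $q$ be a power of a prime $p$, let $\mathcal{T}$ be a multiset of points of $\mathrm{AG}(2,q)$, let $\lambda$ be an integer, and let $\mathcal{E}_\lambda$ be a set of $(q-\lambda)$-uniform directions w.r.t. $\mathcal{T}$, of size at most $q$. For $(d)\in\mathcal{E}_\lambda$ let $m_d$ denote the typical intersection number at $(d)$. Assume that: (i) $0<\lambda\le \min\{q-2,p-1\}$; (ii) for each $(d)\in\mathcal{E}_\lambda$ the renitent lines with slope $d$ all meet $\mathcal{T}$ in the same number, say $t_d$, of points modulo $p$; (iii) the value of $t_d-m_d$ modulo $p$ does not depend on the choice of $(d)\in\mathcal{E}_\lambda$. Then the renitent lines with direction in $\mathcal{E}_\lambda$ are contained in an algebraic envelope of class $\lambda$.
   Context: $\mathrm{AG}(2,q)$ is the desarguesian affine plane over $\mathbb{F}_q$, embedded in $\mathrm{PG}(2,q)$ as the set of points $(a:b:1)$; the line at infinity is $\ell_\infty=[0:0:1]$. Here $[u:v:w]$ denotes the line $\{(x:y:z): ux+vy+wz=0\}$. The points of $\ell_\infty$ are called directions: $(d)=(1:d:0)$ for $d\in\mathbb{F}_q$ and $(\infty)=(0:1:0)$. The affine lines with slope (direction) $d$ are the $q$ affine lines through $(d)$. Multisets are finite, and intersection sizes with $\mathcal{T}$ are counted with multiplicity. A direction $(d)$ is $(q-\lambda)$-uniform w.r.t. $\mathcal{T}$ if at least $q-\lambda$ affine lines with slope $d$ meet $\mathcal{T}$ in the same number of points modulo $p$; this number (modulo $p$) is the typical intersection number at $(d)$. If it is not uniquely determined, one such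 number is fixed for $(d)$. The other affine lines with slope $d$ (those whose intersection size with $\mathcal{T}$ is not congruent to the typical intersection number modulo $p$) are called renitent. An algebraic envelope of class $n$ is a curve of degree $n$ in the dual plane, i.e. it is given by a nonzero homogeneous polynomial $g\in\mathbb{F}_q[U,V,W]$ of degree $n$; a line $[u:v:w]$ is contained in it if $g(u,v,w)=0$. -}

module Defs where

open import Algebra.Bundles using (CommutativeRing; Semiring)
import Algebra.Definitions.RawMonoid as RawMonoidDefs
import Algebra.Definitions.RawSemiring as RawSemiringDefs
open import Algebra.Structures using (IsCommutativeRing)
open import Data.Fin using (Fin; toℕ)
open import Data.Fin.Properties using () renaming (_≟_ to _≟ᶠ_)
open import Data.Integer using (ℤ; +_; _-_)
open import Data.Integer.Divisibility using (_∣_)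
open import Data.List using (List; length; filter)
open import Data.List.Relation.Unary.All using (All)
open import Data.List.Relation.Unary.AllPairs using (AllPairs)
open import Data.Nat using (ℕ; suc; _∸_; _≤_)
open import Data.Product using (_×_; _,_; ∃; ∃-syntax)
open import Function.Bundles using (_↔_)
open import Function.Properties.Inverse using (↔⇒↣)
open import Level using (0ℓ)
open import Relation.Binary.Definitions using (DecidableEquality)
open import Relation.Binary.PropositionalEquality using (_≡_; _≢_)
open import Relation.Nullary using (¬_)
open import Relation.Nullary.Decidable using (via-injection)

-- The library has no (discrete) fields.

record FiniteField (q : ℕ) : Set₁ where
  infixl 7 _*_
  infixl 6 _+_
  infix  8 -_
  field
    Carrier           : Set
    _+_ _*_           : Carrier → Carrier → Carrier
    -_                : Carrier → Carrier
    0# 1#             : Carrier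
    isCommutativeRing : IsCommutativeRing _≡_ _+_ _*_ -_ 0# 1#
    1#≢0#             : 1# ≢ 0#
    inverse           : ∀ x → x ≢ 0# → ∃[ y ] x * y ≡ 1#
    enumeration       : Carrier ↔ Fin q

  commutativeRing : CommutativeRing 0ℓ 0ℓ
  commutativeRing = record { isCommutativeRing = isCommutativeRing }

  open CommutativeRing commutativeRing public using (semiring; +-rawMonoid)
  open Semiring semiring public using (rawSemiring)
  open RawSemiringDefs rawSemiring public using (_^_)
  open RawMonoidDefs +-rawMonoid public using (sum)

  infix 4 _≟_
  _≟_ : DecidableEquality Carrier
  _≟_ = via-injection (↔⇒↣ enumeration) _≟ᶠ_

-- Residues modulo p are represented by arbitrary integers.

infix 4 _≡_[mod_]
_≡_[mod_] : ℤ → ℤ → ℕ → Set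
a ≡ b [mod p ] = + p ∣ (a - b)

module Plane {q : ℕ} (F : FiniteField q) where
  open FiniteField F

  Triple : Set
  Triple = Carrier × Carrier × Carrier

  𝟎 : Triple
  𝟎 = 0# , 0# , 0#

  infix 4 _∼_
  _∼_ : Triple → Triple → Set
  (u , v , w) ∼ (u′ , v′ , w′) =
    ∃[ c ] c ≢ 0# × u ≡ c * u′ × v ≡ c * v′ × w ≡ c * w′

  -- The line comes first, the point second.

  ⟨_,_⟩ : Triple → Triple → Carrier
  ⟨ (u , v , w) , (x , y , z) ⟩ = u * x + v * y + w * z

  AffinePoint : Set
  AffinePoint = Carrier × Carrier

  affine : AffinePoint → Triple
  affine (a , b) = a , b , 1#

  data Direction : Set where
    ⦅_⦆ : Carrier → Direction
    ⦅∞⦆ : Direction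

  atInfinity : Direction → Triple
  atInfinity ⦅ d ⦆ = 1# , d , 0#
  atInfinity ⦅∞⦆   = 0# , 1# , 0#

  ℓ∞ : Triple
  ℓ∞ = 0# , 0# , 1#

  -- A line is given by any of its homogeneous coordinate triples; two
  -- triples give the same line exactly when they are related by _∼_.

  record AffineLineWithSlope (d : Direction) (ℓ : Triple) : Set where
    field
      nonzero : ℓ ≢ 𝟎
      ≁ℓ∞     : ¬ (ℓ ∼ ℓ∞)
      through : ⟨ ℓ , atInfinity d ⟩ ≡ 0#

  AtLeast : ℕ → (Triple → Set) → Set
  AtLeast n P = ∃[ ℓs ] n ≤ length ℓs × AllPairs (λ ℓ ℓ′ → ¬ (ℓ ∼ ℓ′)) ℓs × All P ℓs

  -- A list is used for a finite multiset: only multiplicities are ever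
  -- observed.

  Multiset : Set
  Multiset = List AffinePoint

  ∣_∩_∣ : Triple → Multiset → ℕ
  ∣ ℓ ∩ T ∣ = length (filter (λ P → ⟨ ℓ , affine P ⟩ ≟ 0#) T)

  module _ (p : ℕ) (T : Multiset) where

    -- m is an admissible choice of typical intersection number for the
    -- (q - lam)-uniform direction d.

    Typical : ℕ → Direction → ℤ → Set
    Typical lam d m =
      AtLeast (q ∸ lam) λ ℓ → AffineLineWithSlope d ℓ × + ∣ ℓ ∩ T ∣ ≡ m [mod p ]

    Uniform : ℕ → Direction → Set
    Uniform lam d = ∃[ m ] Typical lam d m

    Renitent : Direction → ℤ → Triple → Set
    Renitent d m ℓ = AffineLineWithSlope d ℓ × ¬ (+ ∣ ℓ ∩ T ∣ ≡ m [mod p ])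

  -- g i j is the coefficient of Uⁱ Vʲ Wⁿ⁻ⁱ⁻ʲ, where i + j ≤ n.

  HomogeneousPolynomial : ℕ → Set
  HomogeneousPolynomial n = (i : Fin (suc n)) → Fin (suc (n ∸ toℕ i)) → Carrier

  eval : ∀ {n} → HomogeneousPolynomial n → Triple → Carrier
  eval {n} g (u , v , w) =
    sum λ i → sum λ j → g i j * (u ^ toℕ i * v ^ toℕ j * w ^ (n ∸ toℕ i ∸ toℕ j))

  record AlgebraicEnvelope (n : ℕ) : Set where
    field
      polynomial : HomogeneousPolynomial n
      nonzero    : ∃[ i ] ∃[ j ] polynomial i j ≢ 0#

  infix 4 _∈ᵉ_
  _∈ᵉ_ : ∀ {n} → Triple → AlgebraicEnvelope n → Set
  ℓ ∈ᵉ 𝓔 = eval (AlgebraicEnvelope.polynomial 𝓔) ℓ ≡ 0#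

{-# OPTIONS --safe #-}

-- Fix the coordinates u, v of the lines of one pencil and put
-- s(a, b) = -(ua + vb), so that (a, b) lies on [u : v : s(a, b)].  In F, the
-- number of points of T on [u : v : c] is μ + δ[c ∈ R], where R consists of the
-- renitent c.  Since Σ_c cⁱ = 0 for 0 < i ≤ q - 2, the power sums of the multiset
-- s(T) are δ times those of R, and they are forms in u and v.  As λ < p, Newton's
-- identities turn them into the coefficients of ∏_{c ∈ R} (1 - ct): these are
-- values of forms aᵢ(u, v) of degree i not depending on the pencil, because δ does
-- not.  The envelope is Σ_{i ≤ λ} aᵢ(U, V) W^(λ-i), which at (u, v, W) equals
-- W^(λ-|R|) ∏_{c ∈ R} (W - c).
module Submission where

open import Defs
open import Algebra.Bundles using (CommutativeRing)
import Algebra.Properties.AbelianGroup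
import Algebra.Properties.CommutativeMonoid.Sum
import Algebra.Properties.CommutativeSemiring.Exp
import Algebra.Properties.Ring
import Algebra.Properties.Semiring.Mult
import Algebra.Properties.Semiring.Sum
import Algebra.Solver.Ring
open import Algebra.Solver.Ring.AlmostCommutativeRing using (fromCommutativeRing; _-Raw-AlmostCommutative⟶_)
open import Data.Bool using (if_then_else_)
open import Data.Empty using (⊥; ⊥-elim)
open import Data.Fin using (Fin; zero; suc; toℕ)
import Data.Fin.Properties as Finₚ
open import Data.Integer using (ℤ; -[1+_]; ∣_∣; _⊖_)
import Data.Integer as ℤ
import Data.Integer.Properties as ℤₚ
open import Data.List using (List; []; _∷_; length; lookup; filter; tabulate; replicate)
import Data.List.Properties as Listₚ
open import Data.List.Membership.Propositional using (_∈_)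
open import Data.List.Membership.Propositional.Properties using (∈-filter⁺; ∈-filter⁻; ∈-lookup; ∈-tabulate⁺)
open import Data.List.Relation.Unary.All as All using (All; []; _∷_)
open import Data.List.Relation.Unary.AllPairs using (AllPairs; []; _∷_)
open import Data.List.Relation.Unary.Any using (here; there)
open import Data.List.Relation.Unary.Unique.Propositional using (Unique)
import Data.List.Relation.Unary.Unique.Propositional.Properties as Uniqueₚ
import Data.Maybe as Maybe
open import Data.Nat using (ℕ; zero; suc; _≤_; _<_; _∸_; z≤n; s≤s)
import Data.Nat as ℕ
open import Data.Nat.Coprimality using (Coprime; coprime-Bézout)
import Data.Nat.Divisibility as ℕ∣
open import Data.Nat.GCD using (module Bézout)
open import Data.Nat.Primality using (Prime; prime⇒irreducible)
import Data.Nat.Properties as ℕₚ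
open import Data.Product using (_×_; _,_; proj₁; proj₂; ∃-syntax)
open import Data.Sum using (inj₁; inj₂)
open import Function using (_∘_; _↔_; Inverse; Injection; mk↔ₛ′)
open import Function.Construct.Composition using (_↔-∘_)
open import Function.Construct.Symmetry using (↔-sym)
open import Function.Properties.Inverse using (↔⇒↣)
open import Relation.Binary.Consequences using (dec⇒weaklyDec)
open import Relation.Binary.Definitions using (WeaklyDecidable)
open import Relation.Binary.PropositionalEquality as ≡ using (_≡_; _≢_)
import Relation.Binary.Reasoning.Setoid
open import Relation.Nullary using (¬_; Dec; yes; no; does; ¬?)
open import Relation.Nullary.Decidable using (decidable-stable)

-- The set R and its size change from pencil to pencil, so the forms cannot be built from R. They
-- are built from T alone, by running Newton's recursion with κ times a sum over T in place of the
-- sum over R, where κ = 1/δ; in each pencil the coefficients of ∏ (1 - ct) then satisfy the same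
-- recursion up to index λ. The coordinates u, v are those of the given line and are not normalised,
-- which lets (∞) be treated like every other direction. The envelope is nonzero because all aᵢ with
-- i > 0 vanish at ℓ∞ and leave the value 1. If δ = 0 in F, there are no renitent lines in the given
-- directions, and κ = 0 serves.

-- Integers as scalars in a commutative ring

module IntegerScalars {c ℓ} (R : CommutativeRing c ℓ) where
  open CommutativeRing R
  open Algebra.Properties.AbelianGroup +-abelianGroup using (ε⁻¹≈ε; ⁻¹-involutive; ⁻¹-∙-comm)
  open Algebra.Properties.Ring ring using (-‿distribˡ-*)
  open Algebra.Properties.Semiring.Mult semiring using (×-homo-+; ×-congʳ; ×-assoc-*) renaming (_×_ to _·_)
  open Relation.Binary.Reasoning.Setoid setoid

  -- The canonical ring homomorphism from ℤ. It supplies the coefficients of the ring solver, and it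
  -- later carries residues modulo p into F.
  ι : ℤ → Carrier
  ι (ℤ.+ n)   = n · 1#
  ι -[1+ n ]  = - (suc n · 1#)

  ι-neg : ∀ i → ι (ℤ.- i) ≈ - ι i
  ι-neg (ℤ.+ zero)  = sym ε⁻¹≈ε
  ι-neg (ℤ.+ suc n) = refl
  ι-neg -[1+ n ]    = sym (⁻¹-involutive _)

  ι-⊖ : ∀ m n → ι (m ⊖ n) ≈ m · 1# + - (n · 1#)
  ι-⊖ zero    zero    = sym (-‿inverseʳ 0#)
  ι-⊖ zero    (suc n) = sym (+-identityˡ _)
  ι-⊖ (suc m) zero    = sym (trans (+-congˡ ε⁻¹≈ε) (+-identityʳ _))
  ι-⊖ (suc m) (suc n) = begin
    ι (suc m ⊖ suc n)                            ≡⟨ ≡.cong ι (ℤₚ.[1+m]⊖[1+n]≡m⊖n m n) ⟩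
    ι (m ⊖ n)                                    ≈⟨ ι-⊖ m n ⟩
    m · 1# + - (n · 1#)                          ≈⟨ +-congˡ (+-identityˡ _) ⟨
    m · 1# + (0# + - (n · 1#))                   ≈⟨ +-congˡ (+-congʳ (-‿inverseʳ 1#)) ⟨
    m · 1# + (1# + - 1# + - (n · 1#))            ≈⟨ +-congˡ (+-assoc _ _ _) ⟩
    m · 1# + (1# + (- 1# + - (n · 1#)))          ≈⟨ +-congˡ (+-congˡ (⁻¹-∙-comm _ _)) ⟩
    m · 1# + (1# + - (1# + n · 1#))              ≈⟨ +-assoc _ _ _ ⟨
    m · 1# + 1# + - (1# + n · 1#)                ≈⟨ +-congʳ (+-comm _ _) ⟩
    1# + m · 1# + - (1# + n · 1#)                ∎

  ι-+ : ∀ i j → ι (i ℤ.+ j) ≈ ι i + ι j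
  ι-+ (ℤ.+ m)  (ℤ.+ n)  = ×-homo-+ 1# m n
  ι-+ (ℤ.+ m)  -[1+ n ] = ι-⊖ m (suc n)
  ι-+ -[1+ m ] (ℤ.+ n)  = trans (ι-⊖ n (suc m)) (+-comm _ _)
  ι-+ -[1+ m ] -[1+ n ] = trans (-‿cong (begin
    suc (suc (m ℕ.+ n)) · 1#     ≡⟨ ≡.cong (λ k → suc k · 1#) (≡.sym (ℕₚ.+-suc m n)) ⟩
    (suc m ℕ.+ suc n) · 1#       ≈⟨ ×-homo-+ 1# (suc m) (suc n) ⟩
    suc m · 1# + suc n · 1#      ∎)) (sym (⁻¹-∙-comm _ _))

  ι-+* : ∀ m j → ι (ℤ.+ m ℤ.* j) ≈ m · ι j
  ι-+* zero    j = refl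
  ι-+* (suc m) j = begin
    ι (ℤ.+ suc m ℤ.* j)        ≡⟨ ≡.cong ι (ℤₚ.suc-* (ℤ.+ m) j) ⟩
    ι (j ℤ.+ ℤ.+ m ℤ.* j)      ≈⟨ ι-+ j (ℤ.+ m ℤ.* j) ⟩
    ι j + ι (ℤ.+ m ℤ.* j)      ≈⟨ +-congˡ (ι-+* m j) ⟩
    ι j + m · ι j              ∎

  ×-as-* : ∀ m x → m · x ≈ (m · 1#) * x
  ×-as-* m x = sym (trans (×-assoc-* m 1# x) (×-congʳ m (*-identityˡ x)))

  ι-* : ∀ i j → ι (i ℤ.* j) ≈ ι i * ι j
  ι-* (ℤ.+ m)  j = trans (ι-+* m j) (×-as-* m (ι j))
  ι-* -[1+ m ] j = begin
    ι (-[1+ m ] ℤ.* j)          ≡⟨ ≡.cong ι (ℤₚ.neg-distribˡ-* (ℤ.+ suc m) j) ⟨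
    ι (ℤ.- (ℤ.+ suc m ℤ.* j))   ≈⟨ ι-neg (ℤ.+ suc m ℤ.* j) ⟩
    - ι (ℤ.+ suc m ℤ.* j)       ≈⟨ -‿cong (ι-* (ℤ.+ suc m) j) ⟩
    - (suc m · 1# * ι j)        ≈⟨ -‿distribˡ-* _ _ ⟩
    - (suc m · 1#) * ι j        ∎

  ι-- : ∀ i j → ι (i ℤ.- j) ≈ ι i + - ι j
  ι-- i j = trans (ι-+ i (ℤ.- j)) (+-congˡ (ι-neg j))

  morphism : ℤ.+-*-rawRing -Raw-AlmostCommutative⟶ fromCommutativeRing R
  morphism = record
    { ⟦_⟧ = ι ; +-homo = ι-+ ; *-homo = ι-* ; -‿homo = ι-neg
    ; 0-homo = refl ; 1-homo = +-identityʳ 1# }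

  -- Distinct integers may have equal images, so only a positive answer is ever certified.
  ι-weaklyDecidable : WeaklyDecidable (λ i j → ι i ≈ ι j)
  ι-weaklyDecidable i j = Maybe.map (λ { ≡.refl → refl }) (dec⇒weaklyDec ℤ._≟_ i j)

  module Solver = Algebra.Solver.Ring ℤ.+-*-rawRing (fromCommutativeRing R) morphism ι-weaklyDecidable

open ≡ using (refl; sym; trans; cong; cong₂; subst; subst₂; module ≡-Reasoning)

-- Finite fields: sums, roots, power sums, characteristic

module Field {q : ℕ} (F : FiniteField q) where
  open FiniteField F
  open CommutativeRing commutativeRing using
    (+-abelianGroup; +-commutativeMonoid; commutativeSemiring; +-assoc; +-comm; +-identityˡ;
     +-identityʳ; +-congˡ; +-congʳ; *-congˡ; -‿inverseˡ; -‿inverseʳ; *-assoc; *-identityˡ;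
     *-identityʳ; zeroˡ; zeroʳ)
  open Algebra.Properties.AbelianGroup +-abelianGroup using (∙-cancelˡ; ⁻¹-involutive; ε⁻¹≈ε; x∙y⁻¹≈ε⇒x≈y)
  open Algebra.Properties.Semiring.Mult semiring using (×1-homo-*) renaming (_×_ to _·_)
  open Algebra.Properties.Semiring.Sum semiring using
    (sum-cong-≗; *-distribˡ-sum; sum-replicate-zero; sum-replicate)
  open Algebra.Properties.CommutativeMonoid.Sum +-commutativeMonoid using (∑-distrib-+; sum-permute)
  open Algebra.Properties.CommutativeSemiring.Exp commutativeSemiring using (^-distrib-*)
  open IntegerScalars commutativeRing using (ι; ι--; module Solver)
  open Solver using (solve; _:=_; _:+_; _:*_; :-_)
  open ≡-Reasoning

  private
    from : Fin q → Carrier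
    from = Inverse.from enumeration

  *-zero-divisor : ∀ {x y} → x ≢ 0# → x * y ≡ 0# → y ≡ 0#
  *-zero-divisor {x} {y} x≢0 xy≡0 with z , xz≡1 ← inverse x x≢0 = begin
    y            ≡⟨ *-identityʳ y ⟨
    y * 1#       ≡⟨ cong (y *_) xz≡1 ⟨
    y * (x * z)  ≡⟨ solve 3 (λ x y z → y :* (x :* z) := z :* (x :* y)) refl x y z ⟩
    z * (x * y)  ≡⟨ cong (z *_) xy≡0 ⟩
    z * 0#       ≡⟨ zeroʳ z ⟩
    0#           ∎

  *-nonzero : ∀ {x y} → x ≢ 0# → y ≢ 0# → x * y ≢ 0#
  *-nonzero x≢0 y≢0 xy≡0 = y≢0 (*-zero-divisor x≢0 xy≡0)

  -- Summing over positions counts repeated entries with multiplicity and makes the lemmas on `sum`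
  -- available for lists.
  sumOver : ∀ {A : Set} → List A → (A → Carrier) → Carrier
  sumOver xs φ = sum (φ ∘ lookup xs)

  sumAll : (Carrier → Carrier) → Carrier
  sumAll φ = sum (φ ∘ from)

  elements : List Carrier
  elements = tabulate from

  𝟙 : ∀ {P : Set} → Dec P → Carrier
  𝟙 P? = if does P? then 1# else 0#

  𝟙-yes : ∀ {P : Set} (P? : Dec P) → P → 𝟙 P? ≡ 1#
  𝟙-yes (yes _) _ = refl
  𝟙-yes (no ¬p) p = ⊥-elim (¬p p)

  𝟙-no : ∀ {P : Set} (P? : Dec P) → ¬ P → 𝟙 P? ≡ 0#
  𝟙-no (yes p) ¬p = ⊥-elim (¬p p)
  𝟙-no (no _)  _  = refl

  sum-zero : ∀ {n} (t : Fin n → Carrier) → (∀ i → t i ≡ 0#) → sum t ≡ 0#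
  sum-zero {n} t t≡0 = trans (sum-cong-≗ t≡0) (sum-replicate-zero n)

  sum-single : ∀ {n} (t : Fin n → Carrier) i → (∀ j → j ≢ i → t j ≡ 0#) → sum t ≡ t i
  sum-single t zero    t≡0 =
    trans (+-congˡ (sum-zero (t ∘ suc) λ j → t≡0 (suc j) λ ())) (+-identityʳ _)
  sum-single t (suc i) t≡0 =
    trans (+-congʳ (t≡0 zero λ ()))
      (trans (+-identityˡ _) (sum-single (t ∘ suc) i λ j j≢i → t≡0 (suc j) (j≢i ∘ Finₚ.suc-injective)))

  sumAll-𝟙 : ∀ {P : Carrier → Set} (P? : ∀ c → Dec (P c)) (φ : Carrier → Carrier) z →
             P z → (∀ c → P c → c ≡ z) →
             sumAll (λ c → 𝟙 (P? c) * φ c) ≡ φ z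
  sumAll-𝟙 P? φ z Pz P-unique = begin
    sumAll t                 ≡⟨ sum-single (t ∘ from) (to z) vanish ⟩
    t (from (to z))          ≡⟨ cong t (strictlyInverseʳ z) ⟩
    t z                      ≡⟨ value ⟩
    φ z                      ∎
    where
    open Inverse enumeration using (to; strictlyInverseʳ; strictlyInverseˡ)
    t : Carrier → Carrier
    t c = 𝟙 (P? c) * φ c
    vanish : ∀ j → j ≢ to z → t (from j) ≡ 0#
    vanish j j≢ = trans (cong (_* φ (from j)) (𝟙-no (P? (from j)) λ p →
      j≢ (trans (sym (strictlyInverseˡ j)) (cong to (P-unique (from j) p))))) (zeroˡ _)
    value : t z ≡ φ z
    value = trans (cong (_* φ z) (𝟙-yes (P? z) Pz)) (*-identityˡ _)

  -- Conjugating π by the enumeration gives a permutation of `Fin q`, to which `sum-permute`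
  -- applies.
  sumAll-reindex : (π : Carrier ↔ Carrier) (φ : Carrier → Carrier) → sumAll (φ ∘ Inverse.to π) ≡ sumAll φ
  sumAll-reindex π φ = begin
    sumAll (φ ∘ Inverse.to π)
      ≡⟨ sum-cong-≗ {x = φ ∘ Inverse.to π ∘ from} (λ i → cong φ (sym (strictlyInverseʳ (Inverse.to π (from i))))) ⟩
    sum (λ i → φ (from (to (Inverse.to π (from i)))))
      ≡⟨ sum-permute (φ ∘ from) (enumeration ↔-∘ (π ↔-∘ ↔-sym enumeration)) ⟨
    sumAll φ                                          ∎
    where open Inverse enumeration using (to; strictlyInverseʳ)

  sumOver-filter : ∀ {A : Set} {P : A → Set} (P? : ∀ x → Dec (P x)) xs φ →
                   sumOver (filter P? xs) φ ≡ sumOver xs (λ x → 𝟙 (P? x) * φ x)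
  sumOver-filter P? []       φ = refl
  sumOver-filter P? (x ∷ xs) φ with P? x
  ... | yes _ = cong₂ _+_ (sym (*-identityˡ (φ x))) (sumOver-filter P? xs φ)
  ... | no  _ = trans (sumOver-filter P? xs φ) (sym (trans (+-congʳ (zeroˡ (φ x))) (+-identityˡ _)))

  length-filter-∷ : ∀ {A : Set} {P : A → Set} (P? : ∀ x → Dec (P x)) x xs →
                    length (filter P? (x ∷ xs)) · 1# ≡ 𝟙 (P? x) + length (filter P? xs) · 1#
  length-filter-∷ P? x xs with P? x
  ... | yes _ = refl
  ... | no  _ = sym (+-identityˡ _)

  sumOver-tabulate : ∀ {A : Set} {n} (h : Fin n → A) φ → sumOver (tabulate h) φ ≡ sum (φ ∘ h)
  sumOver-tabulate {n = zero}  h φ = refl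
  sumOver-tabulate {n = suc n} h φ = +-congˡ (sumOver-tabulate (h ∘ suc) φ)

  length-unique : {xs : List Carrier} → Unique xs → length xs ≤ q
  length-unique xs! = Finₚ.injective⇒≤ (λ eq → lookup-injective xs! _ _ (Injection.injective (↔⇒↣ enumeration) eq))
    where
    lookup-injective : ∀ {xs : List Carrier} → Unique xs → ∀ i j → lookup xs i ≡ lookup xs j → i ≡ j
    lookup-injective (_   ∷ _)   zero    zero    _  = refl
    lookup-injective (x∉ ∷ _)   zero    (suc j) eq = ⊥-elim (All.lookup x∉ (∈-lookup j) eq)
    lookup-injective (x∉ ∷ _)   (suc i) zero    eq = ⊥-elim (All.lookup x∉ (∈-lookup i) (sym eq))
    lookup-injective (_   ∷ xs!) (suc i) (suc j) eq = cong suc (lookup-injective xs! i j eq)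

  elements-unique : Unique elements
  elements-unique = Uniqueₚ.tabulate⁺ (Injection.injective (↔⇒↣ (↔-sym enumeration)))

  length-elements : length elements ≡ q
  length-elements = Listₚ.length-tabulate from

  -- The monic polynomial whose lower coefficients are listed from the constant term on.
  monic : List Carrier → Carrier → Carrier
  monic []       x = 1#
  monic (a ∷ as) x = a + x * monic as x

  -- Horner's scheme: the lower coefficients of the quotient of `monic (a ∷ as)` by x - r. They do
  -- not involve the constant term `a`, so only `as` is passed.
  quotient : List Carrier → Carrier → List Carrier
  quotient []       r = []
  quotient (a ∷ as) r = monic (a ∷ as) r ∷ quotient as r

  length-quotient : ∀ as r → length (quotient as r) ≡ length as
  length-quotient []       r = refl
  length-quotient (_ ∷ as) r = cong suc (length-quotient as r)

  monic-quotient : ∀ a as r x → monic (a ∷ as) x ≡ monic (a ∷ as) r + (x + - r) * monic (quotient as r) x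
  monic-quotient a []       r x =
    solve 4 (λ a r x o → a :+ x :* o := a :+ r :* o :+ (x :+ :- r) :* o) refl a r x 1#
  monic-quotient a (b ∷ as) r x = begin
    a + x * monic (b ∷ as) x
      ≡⟨ cong (λ y → a + x * y) (monic-quotient b as r x) ⟩
    a + x * (monic (b ∷ as) r + (x + - r) * Q)
      ≡⟨ solve 5 (λ a r x h Q → a :+ x :* (h :+ (x :+ :- r) :* Q) := a :+ r :* h :+ (x :+ :- r) :* (h :+ x :* Q))
           refl a r x (monic (b ∷ as) r) Q ⟩
    a + r * monic (b ∷ as) r + (x + - r) * (monic (b ∷ as) r + x * Q)          ∎
    where Q = monic (quotient as r) x

  -- Dividing by x - r for the first root r lowers the degree by one; every other root survives in
  -- the quotient, as a field has no zero divisors.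
  number-of-roots : ∀ as {xs} → Unique xs → All (λ x → monic as x ≡ 0#) xs → length xs ≤ length as
  number-of-roots as       []          []             = z≤n
  number-of-roots []       (_ ∷ _)     (1≡0 ∷ _)      = ⊥-elim (1#≢0# 1≡0)
  number-of-roots (a ∷ as) {r ∷ xs} (r∉xs ∷ xs!) (root ∷ roots) =
    s≤s (subst (length xs ≤_) (length-quotient as r)
      (number-of-roots (quotient as r) xs! (All.zipWith root-of-quotient (r∉xs , roots))))
    where
    root-of-quotient : ∀ {x} → r ≢ x × monic (a ∷ as) x ≡ 0# → monic (quotient as r) x ≡ 0#
    root-of-quotient {x} (r≢x , x-root) = *-zero-divisor (λ x-r≡0 → r≢x (sym (x∙y⁻¹≈ε⇒x≈y x r x-r≡0))) (begin
      (x + - r) * Q                       ≡⟨ +-identityˡ _ ⟨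
      0# + (x + - r) * Q                  ≡⟨ +-congʳ root ⟨
      monic (a ∷ as) r + (x + - r) * Q    ≡⟨ monic-quotient a as r x ⟨
      monic (a ∷ as) x                    ≡⟨ x-root ⟩
      0#                                  ∎)
      where Q = monic (quotient as r) x

  private
    monic-power : ∀ n x → monic (replicate n 0#) x ≡ x ^ n
    monic-power zero    x = refl
    monic-power (suc n) x = trans (+-identityˡ _) (cong (x *_) (monic-power n x))

  -- The monic polynomial X^(n+2) - X, with lower coefficients 0, -1, 0, ..., 0, has degree less
  -- than q and cannot have all q elements as roots.
  x^[2+n]≢x : ∀ n → suc (suc n) < q → ¬ (∀ x → x ^ suc (suc n) ≡ x)
  x^[2+n]≢x n n+2<q fixed = ℕₚ.<⇒≱ n+2<q
    (subst₂ _≤_ length-elements (cong (λ m → suc (suc m)) (Listₚ.length-replicate n))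
      (number-of-roots (0# ∷ - 1# ∷ replicate n 0#) elements-unique (All.universal root elements)))
    where
    root : ∀ x → 0# + x * (- 1# + x * monic (replicate n 0#) x) ≡ 0#
    root x = begin
      0# + x * (- 1# + x * monic (replicate n 0#) x)  ≡⟨ +-identityˡ _ ⟩
      x * (- 1# + x * monic (replicate n 0#) x)       ≡⟨ cong (λ y → x * (- 1# + x * y)) (monic-power n x) ⟩
      x * (- 1# + x * x ^ n)
        ≡⟨ solve 3 (λ x o y → x :* (:- o :+ x :* y) := :- (x :* o) :+ x :* (x :* y)) refl x 1# (x ^ n) ⟩
      - (x * 1#) + x * (x * x ^ n)                    ≡⟨ cong₂ (λ y z → - y + z) (*-identityʳ x) (fixed x) ⟩
      - x + x                                         ≡⟨ -‿inverseˡ x ⟩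
      0#                                              ∎

  *-permutation : ∀ {y} → y ≢ 0# → Carrier ↔ Carrier
  *-permutation {y} y≢0 with z , yz≡1 ← inverse y y≢0 =
    mk↔ₛ′ (y *_) (z *_) cancel (λ c → trans (solve 3 (λ y z c → z :* (y :* c) := y :* (z :* c)) refl y z c) (cancel c))
    where
    cancel : ∀ c → y * (z * c) ≡ c
    cancel c = trans (sym (*-assoc y z c)) (trans (cong (_* c) yz≡1) (*-identityˡ c))

  -- Multiplication by y ≠ 0 permutes F, hence y^(n+1) S = S. If S were nonzero, every nonzero y
  -- would satisfy y^(n+1) = 1, contradicting `x^[2+n]≢x`. No generator of the multiplicative group
  -- is needed.
  power-sum : ∀ n → suc (suc n) < q → sumAll (_^ suc n) ≡ 0#
  power-sum n n+2<q = decidable-stable (S ≟ 0#) λ S≢0 → x^[2+n]≢x n n+2<q (fixed S≢0)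
    where
    S = sumAll (_^ suc n)
    scale : ∀ y → y ≢ 0# → y ^ suc n * S ≡ S
    scale y y≢0 = begin
      y ^ suc n * S                            ≡⟨ *-distribˡ-sum (y ^ suc n) ((_^ suc n) ∘ from) ⟩
      sumAll (λ c → y ^ suc n * c ^ suc n)     ≡⟨ sum-cong-≗ (λ i → ^-distrib-* y (from i) (suc n)) ⟨
      sumAll (λ c → (y * c) ^ suc n)           ≡⟨ sumAll-reindex (*-permutation y≢0) (_^ suc n) ⟩
      S                                        ∎
    fixed : S ≢ 0# → ∀ x → x ^ suc (suc n) ≡ x
    fixed S≢0 x with x ≟ 0#
    ... | yes refl = zeroˡ _
    ... | no x≢0   = trans (cong (x *_) x^≡1) (*-identityʳ x)
      where
      x^≡1 : x ^ suc n ≡ 1#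
      x^≡1 = x∙y⁻¹≈ε⇒x≈y _ _ (*-zero-divisor S≢0 (begin
        S * (x ^ suc n + - 1#)
          ≡⟨ solve 3 (λ S x o → S :* (x :+ :- o) := x :* S :+ :- (S :* o)) refl S (x ^ suc n) 1# ⟩
        x ^ suc n * S + - (S * 1#)     ≡⟨ cong₂ (λ a b → a + - b) (scale x x≢0) (*-identityʳ S) ⟩
        S + - S                        ≡⟨ -‿inverseʳ S ⟩
        0#                             ∎))

  +-permutation : Carrier → Carrier ↔ Carrier
  +-permutation y = mk↔ₛ′ (y +_) (- y +_)
    (λ c → trans (sym (+-assoc _ _ _)) (trans (cong (_+ c) (-‿inverseʳ y)) (+-identityˡ c)))
    (λ c → trans (sym (+-assoc _ _ _)) (trans (cong (_+ c) (-‿inverseˡ y)) (+-identityˡ c)))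

  -- The translation c ↦ 1 + c permutes F, so adding 1 to each of the q elements leaves their sum
  -- unchanged.
  q·1≡0 : q · 1# ≡ 0#
  q·1≡0 = ∙-cancelˡ S _ _ (begin
    S + q · 1#                ≡⟨ +-comm S _ ⟩
    q · 1# + S                ≡⟨ cong (_+ S) (sum-replicate q) ⟨
    sumAll (λ _ → 1#) + S     ≡⟨ ∑-distrib-+ (λ _ → 1#) from ⟨
    sumAll (1# +_)            ≡⟨ sumAll-reindex (+-permutation 1#) (λ c → c) ⟩
    S                         ≡⟨ +-identityʳ S ⟨
    S + 0#                    ∎)
    where S = sumAll (λ c → c)

  module Characteristic {p k : ℕ} (p-prime : Prime p) (q≡p^k : q ≡ p ℕ.^ k) where

    -- By `q·1≡0`, the k-th power of p · 1 is zero, and F has no zero divisors.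
    p·1≡0 : p · 1# ≡ 0#
    p·1≡0 = decidable-stable (p · 1# ≟ 0#) λ p≢0 → power≢0 p≢0 k (trans (cong (_· 1#) (sym q≡p^k)) q·1≡0)
      where
      power≢0 : p · 1# ≢ 0# → ∀ j → (p ℕ.^ j) · 1# ≢ 0#
      power≢0 p≢0 zero    eq = 1#≢0# (trans (sym (+-identityʳ 1#)) eq)
      power≢0 p≢0 (suc j) eq = *-nonzero p≢0 (power≢0 p≢0 j) (trans (sym (×1-homo-* p (p ℕ.^ j))) eq)

    p∣⇒·1≡0 : ∀ {n} → p ℕ∣.∣ n → n · 1# ≡ 0#
    p∣⇒·1≡0 (ℕ∣.divides x refl) = trans (×1-homo-* x p) (trans (*-congˡ p·1≡0) (zeroʳ _))

    -- Otherwise n is coprime to p, and a Bézout identity would express 1 through the two zero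
    -- elements p · 1 and n · 1.
    ·1≡0⇒p∣ : ∀ {n} → n · 1# ≡ 0# → p ℕ∣.∣ n
    ·1≡0⇒p∣ {n} n·1≡0 = decidable-stable (p ℕ∣.∣? n) λ p∤n → 1#≢0# (unit (coprime-Bézout (coprime p∤n)))
      where
      coprime : ¬ p ℕ∣.∣ n → Coprime p n
      coprime p∤n {d} (d∣p , d∣n) with prime⇒irreducible p-prime d∣p
      ... | inj₁ d≡1  = d≡1
      ... | inj₂ refl = ⊥-elim (p∤n d∣n)
      1≡0 : ∀ {a b} → a · 1# ≡ 0# → b · 1# ≡ 0# → ∀ x y → 1 ℕ.+ y ℕ.* b ≡ x ℕ.* a → 1# ≡ 0#
      1≡0 {a} {b} a≡0 b≡0 x y eq = begin
        1#                           ≡⟨ +-identityʳ 1# ⟨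
        1# + 0#                      ≡⟨ cong (1# +_) (trans (×1-homo-* y b) (trans (*-congˡ b≡0) (zeroʳ _))) ⟨
        (1 ℕ.+ y ℕ.* b) · 1#         ≡⟨ cong (_· 1#) eq ⟩
        (x ℕ.* a) · 1#               ≡⟨ trans (×1-homo-* x a) (trans (*-congˡ a≡0) (zeroʳ _)) ⟩
        0#                           ∎
      unit : Bézout.Identity 1 p n → 1# ≡ 0#
      unit (Bézout.+- x y eq) = 1≡0 p·1≡0 n·1≡0 x y eq
      unit (Bézout.-+ x y eq) = 1≡0 n·1≡0 p·1≡0 y x eq

    -- This permits the divisions by 1, ..., λ in Newton's identities.
    ·1≢0 : ∀ {n} → suc n < p → suc n · 1# ≢ 0#
    ·1≢0 n<p eq = ℕ∣.>⇒∤ n<p (·1≡0⇒p∣ eq)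

    private
      ι≡0⇒ : ∀ i → ι i ≡ 0# → ∣ i ∣ · 1# ≡ 0#
      ι≡0⇒ (ℤ.+ n)    eq = eq
      ι≡0⇒ -[1+ n ] eq = trans (sym (⁻¹-involutive _)) (trans (cong -_ eq) ε⁻¹≈ε)

      ι≡0⇐ : ∀ i → ∣ i ∣ · 1# ≡ 0# → ι i ≡ 0#
      ι≡0⇐ (ℤ.+ n)    eq = eq
      ι≡0⇐ -[1+ n ] eq = trans (cong -_ eq) ε⁻¹≈ε

    -- Together with the converse `ι⇒mod`, this replaces congruences modulo p by equations in F,
    -- which are decidable and open to field arithmetic.
    mod⇒ι : ∀ i j → i ≡ j [mod p ] → ι i ≡ ι j
    mod⇒ι i j i≡j = x∙y⁻¹≈ε⇒x≈y _ _ (trans (sym (ι-- i j)) (ι≡0⇐ (i ℤ.- j) (p∣⇒·1≡0 i≡j)))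

    ι⇒mod : ∀ i j → ι i ≡ ι j → i ≡ j [mod p ]
    ι⇒mod i j eq = ·1≡0⇒p∣ (ι≡0⇒ (i ℤ.- j) (trans (ι-- i j) (trans (+-congʳ eq) (-‿inverseʳ _))))

-- Ternary forms and their closure properties

module Forms {q : ℕ} (F : FiniteField q) where
  open FiniteField F
  open Plane F
  open Field F
  open CommutativeRing commutativeRing using
    (+-commutativeMonoid; +-identityˡ; +-identityʳ; +-congˡ; +-congʳ; *-congˡ; zeroˡ; zeroʳ;
     distribʳ; *-assoc; *-identityʳ; *-identityˡ)
  open Algebra.Properties.Semiring.Sum semiring using (sum-cong-≗; *-distribˡ-sum)
  open Algebra.Properties.CommutativeMonoid.Sum +-commutativeMonoid using (∑-distrib-+)
  open IntegerScalars commutativeRing using (module Solver)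
  open Solver using (solve; _:=_; _:+_; _:*_)
  open ≡-Reasoning

  private
    term : ∀ {n} → HomogeneousPolynomial n → Triple → (i : Fin (suc n)) → Fin (suc (n ∸ toℕ i)) → Carrier
    term {n} g (u , v , w) i j = g i j * (u ^ toℕ i * v ^ toℕ j * w ^ (n ∸ toℕ i ∸ toℕ j))

    -- One row of a coefficient table, belonging to a fixed power of U, as a binary form in V and W.
    -- Splitting off the row of U⁰ leaves U times a form of degree one less; this is the recursion
    -- `eval-suc` behind the inductions on forms.
    binary : ∀ n → (Fin (suc n) → Carrier) → Carrier → Carrier → Carrier
    binary n c v w = sum λ j → c j * (v ^ toℕ j * w ^ (n ∸ toℕ j))

    binary-zero : ∀ c v w → binary 0 c v w ≡ c zero
    binary-zero c v w = trans (+-identityʳ _) (trans (*-congˡ (*-identityʳ 1#)) (*-identityʳ _))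

    binary-suc : ∀ n c v w → binary (suc n) c v w ≡ c zero * w ^ suc n + v * binary n (c ∘ suc) v w
    binary-suc n c v w = cong₂ _+_ (*-congˡ (*-identityˡ _)) (begin
      sum (λ j → c (suc j) * (v * v ^ toℕ j * w ^ (n ∸ toℕ j)))
        ≡⟨ sum-cong-≗ {y = λ j → v * t j} (λ j → solve 4 (λ c v x y → c :* (v :* x :* y) := v :* (c :* (x :* y)))
             refl (c (suc j)) v (v ^ toℕ j) (w ^ (n ∸ toℕ j))) ⟩
      sum (λ j → v * t j)
        ≡⟨ *-distribˡ-sum v t ⟨
      v * binary n (c ∘ suc) v w  ∎)
      where
      t : Fin (suc n) → Carrier
      t j = c (suc j) * (v ^ toℕ j * w ^ (n ∸ toℕ j))

    eval-zero : ∀ (g : HomogeneousPolynomial 0) ℓ → eval g ℓ ≡ g zero zero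
    eval-zero g (u , v , w) = trans (+-identityʳ _) (trans (+-identityʳ _)
      (trans (*-congˡ (trans (*-identityʳ (1# * 1#)) (*-identityʳ 1#))) (*-identityʳ _)))

    eval-suc : ∀ {n} (g : HomogeneousPolynomial (suc n)) u v w →
               eval g (u , v , w) ≡ binary (suc n) (g zero) v w + u * eval {n} (g ∘ suc) (u , v , w)
    eval-suc {n} g u v w = cong₂ _+_
      (sum-cong-≗ {y = λ j → g zero j * (v ^ toℕ j * w ^ (suc n ∸ toℕ j))}
        (λ j → cong (λ x → g zero j * (x * w ^ (suc n ∸ toℕ j))) (*-identityˡ _)))
      (begin
        sum (λ i → sum (λ j → g (suc i) j * (u * u ^ toℕ i * v ^ toℕ j * w ^ (n ∸ toℕ i ∸ toℕ j))))
          ≡⟨ sum-cong-≗ {y = λ i → u * sum (term {n} (g ∘ suc) (u , v , w) i)} (λ i → trans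
               (sum-cong-≗ {y = λ j → u * term {n} (g ∘ suc) (u , v , w) i j} (λ j → solve 5 (λ g u x y z → g :* (u :* x :* y :* z) := u :* (g :* (x :* y :* z)))
                    refl (g (suc i) j) u (u ^ toℕ i) (v ^ toℕ j) (w ^ (n ∸ toℕ i ∸ toℕ j))))
               (sym (*-distribˡ-sum u (term {n} (g ∘ suc) (u , v , w) i)))) ⟩
        sum (λ i → u * sum (term {n} (g ∘ suc) (u , v , w) i))
          ≡⟨ *-distribˡ-sum u (λ i → sum (term {n} (g ∘ suc) (u , v , w) i)) ⟨
        u * eval {n} (g ∘ suc) (u , v , w) ∎)

    shift : ∀ {n} → (Fin (suc n) → Carrier) → Fin (suc (suc n)) → Carrier
    shift c zero    = 0#
    shift c (suc j) = c j

    -- Multiplication of a row by W: exponents of V stay as they are, and the new top power of V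
    -- gets coefficient 0. (Multiplication by V is `shift`.)
    pad : ∀ n → (Fin (suc n) → Carrier) → Fin (suc (suc n)) → Carrier
    pad n       c zero       = c zero
    pad zero    c (suc zero) = 0#
    pad (suc n) c (suc j)    = pad n (c ∘ suc) j

    binary-shift : ∀ n c v w → binary (suc n) (shift c) v w ≡ v * binary n c v w
    binary-shift n c v w = trans (binary-suc n (shift c) v w) (trans (+-congʳ (zeroˡ _)) (+-identityˡ _))

    binary-pad : ∀ n c v w → binary (suc n) (pad n c) v w ≡ w * binary n c v w
    binary-pad zero    c v w = begin
      binary 1 (pad 0 c) v w                        ≡⟨ binary-suc 0 (pad 0 c) v w ⟩
      c zero * (w * 1#) + v * binary 0 (λ _ → 0#) v w
        ≡⟨ cong (λ x → c zero * (w * 1#) + v * x) (binary-zero (λ _ → 0#) v w) ⟩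
      c zero * (w * 1#) + v * 0#                    ≡⟨ trans (+-congˡ (zeroʳ v)) (+-identityʳ _) ⟩
      c zero * (w * 1#)
        ≡⟨ solve 3 (λ c w o → c :* (w :* o) := w :* (c :* o)) refl (c zero) w 1# ⟩
      w * (c zero * 1#)                             ≡⟨ cong (w *_) (*-identityʳ _) ⟩
      w * c zero                                    ≡⟨ cong (w *_) (binary-zero c v w) ⟨
      w * binary 0 c v w                            ∎
    binary-pad (suc n) c v w = begin
      binary (suc (suc n)) (pad (suc n) c) v w                           ≡⟨ binary-suc (suc n) (pad (suc n) c) v w ⟩
      c zero * (w * w ^ suc n) + v * binary (suc n) (pad n (c ∘ suc)) v w
        ≡⟨ cong (λ x → c zero * (w * w ^ suc n) + v * x) (binary-pad n (c ∘ suc) v w) ⟩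
      c zero * (w * w ^ suc n) + v * (w * binary n (c ∘ suc) v w)
        ≡⟨ solve 5 (λ c v w x y → c :* (w :* x) :+ v :* (w :* y) := w :* (c :* x :+ v :* y))
             refl (c zero) v w (w ^ suc n) (binary n (c ∘ suc) v w) ⟩
      w * (c zero * w ^ suc n + v * binary n (c ∘ suc) v w)                ≡⟨ cong (w *_) (binary-suc n c v w) ⟨
      w * binary (suc n) c v w                                           ∎

    mulU : ∀ n → HomogeneousPolynomial n → HomogeneousPolynomial (suc n)
    mulU n g zero    j = 0#
    mulU n g (suc i) j = g i j

    -- Multiplication by V or W preserves the power of U, hence acts row by row; the additional last
    -- row, for U^(n+1), is zero.
    mapRows : (∀ n → (Fin (suc n) → Carrier) → Fin (suc (suc n)) → Carrier) →
              ∀ n → HomogeneousPolynomial n → HomogeneousPolynomial (suc n)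
    mapRows ρ n       g zero       = ρ n (g zero)
    mapRows ρ zero    g (suc zero) = λ _ → 0#
    mapRows ρ (suc n) g (suc i)    = mapRows ρ n (g ∘ suc) i

    eval-mulU : ∀ n g u v w → eval (mulU n g) (u , v , w) ≡ u * eval {n} g (u , v , w)
    eval-mulU n g u v w = trans (eval-suc (mulU n g) u v w)
      (trans (+-congʳ (sum-zero {suc (suc n)} (λ j → 0# * (v ^ toℕ j * w ^ (suc n ∸ toℕ j))) λ j → zeroˡ _)) (+-identityˡ _))

    eval-mapRows : ∀ {s v w} ρ → (∀ n c → binary (suc n) (ρ n c) v w ≡ s * binary n c v w) →
                   ∀ n g u → eval (mapRows ρ n g) (u , v , w) ≡ s * eval {n} g (u , v , w)
    eval-mapRows {s} {v} {w} ρ scales zero g u = begin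
      eval (mapRows ρ 0 g) (u , v , w)                                    ≡⟨ eval-suc (mapRows ρ 0 g) u v w ⟩
      binary 1 (ρ 0 (g zero)) v w + u * eval {0} (λ _ _ → 0#) (u , v , w)
        ≡⟨ cong₂ (λ x y → x + u * y) (scales 0 (g zero)) (eval-zero (λ _ _ → 0#) (u , v , w)) ⟩
      s * binary 0 (g zero) v w + u * 0#                                  ≡⟨ trans (+-congˡ (zeroʳ u)) (+-identityʳ _) ⟩
      s * binary 0 (g zero) v w                                           ≡⟨ cong (s *_) (binary-zero (g zero) v w) ⟩
      s * g zero zero                                                     ≡⟨ cong (s *_) (eval-zero g (u , v , w)) ⟨
      s * eval {0} g (u , v , w)                                          ∎
    eval-mapRows {s} {v} {w} ρ scales (suc n) g u = begin
      eval (mapRows ρ (suc n) g) (u , v , w)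
        ≡⟨ eval-suc (mapRows ρ (suc n) g) u v w ⟩
      binary (suc (suc n)) (ρ (suc n) (g zero)) v w + u * eval (mapRows ρ n (g ∘ suc)) (u , v , w)
        ≡⟨ cong₂ (λ x y → x + u * y) (scales (suc n) (g zero)) (eval-mapRows ρ scales n (g ∘ suc) u) ⟩
      s * binary (suc n) (g zero) v w + u * (s * eval {n} (g ∘ suc) (u , v , w))
        ≡⟨ solve 4 (λ s b u e → s :* b :+ u :* (s :* e) := s :* (b :+ u :* e))
             refl s (binary (suc n) (g zero) v w) u (eval {n} (g ∘ suc) (u , v , w)) ⟩
      s * (binary (suc n) (g zero) v w + u * eval {n} (g ∘ suc) (u , v , w))
        ≡⟨ cong (s *_) (eval-suc g u v w) ⟨
      s * eval g (u , v , w) ∎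

  -- Later constructions are written as functions on triples, and the closure rules below assemble
  -- the coefficient tables. The table is kept as a witness, since over a finite field the values do
  -- not determine it.
  IsForm : ℕ → (Triple → Carrier) → Set
  IsForm n f = ∃[ g ] (∀ ℓ → eval {n} g ℓ ≡ f ℓ)

  form-const : ∀ c → IsForm 0 (λ _ → c)
  form-const c = (λ _ _ → c) , eval-zero (λ _ _ → c)

  form-0 : ∀ {n} → IsForm n (λ _ → 0#)
  form-0 {n} = (λ _ _ → 0#) , λ { (u , v , w) →
    sum-zero (λ i → sum (term {n} (λ _ _ → 0#) (u , v , w) i)) λ i →
    sum-zero (term {n} (λ _ _ → 0#) (u , v , w) i) λ j → zeroˡ _ }

  form-+ : ∀ {n f f′} → IsForm n f → IsForm n f′ → IsForm n (λ ℓ → f ℓ + f′ ℓ)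
  form-+ {n} (g , eval-g) (g′ , eval-g′) = (λ i j → g i j + g′ i j) ,
    λ ℓ → trans (additive ℓ) (cong₂ _+_ (eval-g ℓ) (eval-g′ ℓ))
    where
    additive : ∀ ℓ → eval {n} (λ i j → g i j + g′ i j) ℓ ≡ eval g ℓ + eval g′ ℓ
    additive ℓ@(u , v , w) = trans
      (sum-cong-≗ {x = λ i → sum (term {n} (λ i j → g i j + g′ i j) ℓ i)} {y = λ i → sum (t i) + sum (t′ i)} λ i → trans
        (sum-cong-≗ {x = term {n} (λ i j → g i j + g′ i j) ℓ i} {y = λ j → t i j + t′ i j} (λ j → distribʳ _ (g i j) (g′ i j)))
        (∑-distrib-+ (t i) (t′ i)))
      (∑-distrib-+ (λ i → sum (t i)) (λ i → sum (t′ i)))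
      where
      t  = term {n} g ℓ
      t′ = term {n} g′ ℓ

  form-scale : ∀ {n f} a → IsForm n f → IsForm n (λ ℓ → a * f ℓ)
  form-scale {n} a (g , eval-g) = (λ i j → a * g i j) , λ ℓ → trans (linear ℓ) (cong (a *_) (eval-g ℓ))
    where
    linear : ∀ ℓ → eval {n} (λ i j → a * g i j) ℓ ≡ a * eval g ℓ
    linear ℓ@(u , v , w) = sym (trans (*-distribˡ-sum a (λ i → sum (t i)))
      (sum-cong-≗ {x = λ i → a * sum (t i)} {y = λ i → sum (term {n} (λ i j → a * g i j) ℓ i)} λ i → trans (*-distribˡ-sum a (t i))
      (sum-cong-≗ {x = λ j → a * t i j} {y = term {n} (λ i j → a * g i j) ℓ i} λ j → sym (*-assoc a (g i j) _))))
      where t = term {n} g ℓ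

  form-cong : ∀ {n f f′} → (∀ ℓ → f ℓ ≡ f′ ℓ) → IsForm n f → IsForm n f′
  form-cong f≡f′ (g , eval-g) = g , λ ℓ → trans (eval-g ℓ) (f≡f′ ℓ)

  form-*U : ∀ {n f} → IsForm n f → IsForm (suc n) (λ ℓ → proj₁ ℓ * f ℓ)
  form-*U {n} (g , eval-g) = mulU n g , λ { ℓ@(u , v , w) → trans (eval-mulU n g u v w) (cong (u *_) (eval-g ℓ)) }

  form-*V : ∀ {n f} → IsForm n f → IsForm (suc n) (λ ℓ → proj₁ (proj₂ ℓ) * f ℓ)
  form-*V {n} (g , eval-g) = mapRows (λ _ → shift) n g , λ { ℓ@(u , v , w) →
    trans (eval-mapRows (λ _ → shift) (λ n c → binary-shift n c v w) n g u) (cong (v *_) (eval-g ℓ)) }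

  form-*W : ∀ {n f} → IsForm n f → IsForm (suc n) (λ ℓ → proj₂ (proj₂ ℓ) * f ℓ)
  form-*W {n} (g , eval-g) = mapRows pad n g , λ { ℓ@(u , v , w) →
    trans (eval-mapRows pad (λ n c → binary-pad n c v w) n g u) (cong (w *_) (eval-g ℓ)) }

  form-sumOver : ∀ {A : Set} {n} {f : A → Triple → Carrier} (xs : List A) → (∀ x → IsForm n (f x)) →
                 IsForm n (λ ℓ → sumOver xs (λ x → f x ℓ))
  form-sumOver []       forms = form-0
  form-sumOver (x ∷ xs) forms = form-+ (forms x) (form-sumOver xs forms)

  -- A finite search over the table yields the indices: were all coefficients zero, so would be
  -- every value.
  form-nonzero : ∀ {n f ℓ} ((g , _) : IsForm n f) → f ℓ ≢ 0# → ∃[ i ] ∃[ j ] g i j ≢ 0#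
  form-nonzero {n} {f} {ℓ} (g , eval-g) fℓ≢0 =
    decidable-stable (Finₚ.any? λ i → Finₚ.any? λ j → ¬? (g i j ≟ 0#)) λ all-zero →
    fℓ≢0 (begin
      f ℓ                            ≡⟨ eval-g ℓ ⟨
      eval g ℓ                       ≡⟨ vanish all-zero ℓ ⟩
      0#                             ∎)
    where
    vanish : ¬ (∃[ i ] ∃[ j ] g i j ≢ 0#) → ∀ ℓ → eval g ℓ ≡ 0#
    vanish all-zero ℓ@(u , v , w) =
      sum-zero (λ i → sum (term {n} g ℓ i)) λ i →
      sum-zero (term {n} g ℓ i) λ j →
      trans (cong (_* (u ^ toℕ i * v ^ toℕ j * w ^ (n ∸ toℕ i ∸ toℕ j)))
        (decidable-stable (g i j ≟ 0#) λ g≢0 → all-zero (i , j , g≢0))) (zeroˡ _)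

-- Newton's identities and the product over the renitent values

module Newton {q : ℕ} (F : FiniteField q) where
  open FiniteField F
  open Field F
  open CommutativeRing commutativeRing using
    (+-commutativeMonoid; +-identityˡ; +-identityʳ; +-congˡ; +-congʳ; *-congˡ; -‿inverseʳ; zeroˡ;
     zeroʳ; *-identityˡ)
  open Algebra.Properties.Semiring.Mult semiring using () renaming (_×_ to _·_)
  open Algebra.Properties.Semiring.Sum semiring using (sum-cong-≗; *-distribˡ-sum)
  open Algebra.Properties.CommutativeMonoid.Sum +-commutativeMonoid using (∑-distrib-+)
  open IntegerScalars commutativeRing using (module Solver)
  open Solver using (solve; _:=_; _:+_; _:*_; :-_)
  open ≡-Reasoning

  sum-linear : ∀ {n} (f g : Fin n → Carrier) a b → sum (λ i → a * f i + b * g i) ≡ a * sum f + b * sum g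
  sum-linear f g a b = trans (∑-distrib-+ (λ i → a * f i) (λ i → b * g i))
    (sym (cong₂ _+_ (*-distribˡ-sum a f) (*-distribˡ-sum b g)))

  -- Multiplication of the power series Σ aₙ tⁿ by 1 - st.
  times : Carrier → (ℕ → Carrier) → ℕ → Carrier
  times s a zero    = a zero
  times s a (suc n) = a (suc n) + - (s * a n)

  -- The coefficients of ∏ (1 - st) over the listed s.
  vieta : List Carrier → ℕ → Carrier
  vieta []       zero    = 1#
  vieta []       (suc n) = 0#
  vieta (s ∷ ss)         = times s (vieta ss)

  -- Σ_{1 ≤ i ≤ n} sⁱ aₙ₋ᵢ
  conv : Carrier → (ℕ → Carrier) → ℕ → Carrier
  conv s a zero    = 0#
  conv s a (suc n) = s * (a n + conv s a n)

  -- On power series `conv r` is multiplication by rt/(1 - rt), which commutes with multiplication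
  -- by 1 - st.
  conv-times : ∀ r s a n → conv r (times s a) (suc n) ≡ conv r a (suc n) + - s * conv r a n
  conv-times r s a zero    = trans (sym (+-identityʳ _)) (+-congˡ (sym (zeroʳ (- s))))
  conv-times r s a (suc n) = trans (cong (λ x → r * (times s a (suc n) + x)) (conv-times r s a n))
    (solve 6 (λ r s a₁ a₀ c₁ c₀ → r :* (a₁ :+ :- (s :* a₀) :+ (c₁ :+ :- s :* c₀)) := r :* (a₁ :+ c₁) :+ :- s :* (r :* (a₀ :+ c₀)))
      refl r s (a (suc n)) (a n) (conv r a (suc n)) (conv r a n))

  -- The coefficient of tⁿ in tA′ + Σ_s st/(1 - st) · A = 0, the logarithmic derivative of A = ∏ (1
  -- - st). The sum over s stays outermost so that it can be exchanged for a sum over T in a single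
  -- step.
  newton : ∀ ss n → n · 1# * vieta ss n + sumOver ss (λ s → conv s (vieta ss) n) ≡ 0#
  newton ss       zero    = trans (cong₂ _+_ (zeroˡ _) (sum-zero {length ss} (λ _ → 0#) λ _ → refl)) (+-identityʳ 0#)
  newton []       (suc n) = trans (+-identityʳ _) (zeroʳ _)
  newton (s ∷ ss) (suc n) = begin
    (1# + ν) * (a₁ + - (s * a₀)) + (conv s (times s a) (suc n) + sumOver ss (λ r → conv r (times s a) (suc n)))
      ≡⟨ cong (λ x → (1# + ν) * (a₁ + - (s * a₀)) + x) (cong₂ _+_ self (trans
           (sum-cong-≗ {x = λ i → conv (lookup ss i) (times s a) (suc n)}
                       {y = λ i → 1# * conv (lookup ss i) a (suc n) + - s * conv (lookup ss i) a n}
             (λ i → trans (conv-times (lookup ss i) s a n) (+-congʳ (sym (*-identityˡ _)))))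
           (sum-linear (λ i → conv (lookup ss i) a (suc n)) (λ i → conv (lookup ss i) a n) 1# (- s)))) ⟩
    (1# + ν) * (a₁ + - (s * a₀)) + (1# * (s * a₀) + (1# * X₁ + - s * X₀))
      ≡⟨ cong (λ x → (1# + ν) * (a₁ + - (s * a₀)) + (1# * (s * a₀) + (x + - s * X₀))) (*-identityˡ X₁) ⟩
    (1# + ν) * (a₁ + - (s * a₀)) + (1# * (s * a₀) + (X₁ + - s * X₀))
      ≡⟨ solve 7 (λ o ν a₁ a₀ s X₁ X₀ → (o :+ ν) :* (a₁ :+ :- (s :* a₀)) :+ (o :* (s :* a₀) :+ (X₁ :+ :- s :* X₀))
           := (o :+ ν) :* a₁ :+ X₁ :+ :- s :* (ν :* a₀ :+ X₀)) refl 1# ν a₁ a₀ s X₁ X₀ ⟩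
    (1# + ν) * a₁ + X₁ + - s * (ν * a₀ + X₀)
      ≡⟨ cong₂ (λ x y → x + - s * y) (newton ss (suc n)) (newton ss n) ⟩
    0# + - s * 0#
      ≡⟨ trans (+-identityˡ _) (zeroʳ _) ⟩
    0# ∎
    where
    a = vieta ss
    ν = n · 1#
    a₁ = a (suc n)
    a₀ = a n
    X₁ = sumOver ss (λ r → conv r a (suc n))
    X₀ = sumOver ss (λ r → conv r a n)
    -- For the new element the denominator cancels: st/(1 - st) times (1 - st)A is stA.
    self : conv s (times s a) (suc n) ≡ 1# * (s * a₀)
    self = begin
      conv s (times s a) (suc n)              ≡⟨ conv-times s s a n ⟩
      s * (a₀ + conv s a n) + - s * conv s a n
        ≡⟨ solve 3 (λ s a c → s :* (a :+ c) :+ :- s :* c := s :* a) refl s a₀ (conv s a n) ⟩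
      s * a₀                                  ≡⟨ *-identityˡ _ ⟨
      1# * (s * a₀)                           ∎

  vieta-vanishes : ∀ ss {n} → length ss < n → vieta ss n ≡ 0#
  vieta-vanishes []       (s≤s _)  = refl
  vieta-vanishes (s ∷ ss) {suc n} (s≤s <n) = begin
    vieta ss (suc n) + - (s * vieta ss n)
      ≡⟨ cong₂ (λ x y → x + - (s * y)) (vieta-vanishes ss (ℕₚ.m≤n⇒m≤1+n <n)) (vieta-vanishes ss <n) ⟩
    0# + - (s * 0#)                         ≡⟨ cong (λ x → 0# + - x) (zeroʳ s) ⟩
    0# + - 0#                               ≡⟨ -‿inverseʳ 0# ⟩
    0#                                      ∎

  -- Σ_{0 ≤ i ≤ n} aᵢ wⁿ⁻ⁱ
  reversed : (ℕ → Carrier) → Carrier → ℕ → Carrier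
  reversed a w zero    = a zero
  reversed a w (suc n) = w * reversed a w n + a (suc n)

  reversed-cong : ∀ {a b} w n → (∀ {i} → i ≤ n → a i ≡ b i) → reversed a w n ≡ reversed b w n
  reversed-cong w zero    a≡b = a≡b z≤n
  reversed-cong w (suc n) a≡b = cong₂ (λ x y → w * x + y) (reversed-cong w n (λ i≤n → a≡b (ℕₚ.m≤n⇒m≤1+n i≤n))) (a≡b ℕₚ.≤-refl)

  reversed-times : ∀ s a w n → reversed (times s a) w (suc n) ≡ reversed a w (suc n) + - (s * reversed a w n)
  reversed-times s a w zero    = solve 4 (λ s a₀ a₁ w → w :* a₀ :+ (a₁ :+ :- (s :* a₀)) := w :* a₀ :+ a₁ :+ :- (s :* a₀))
       refl s (a 0) (a 1) w
  reversed-times s a w (suc n) = trans (cong (λ x → w * x + times s a (suc (suc n))) (reversed-times s a w n))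
    (solve 6 (λ w s r₁ r₀ a₂ a₁ → w :* (r₁ :+ :- (s :* r₀)) :+ (a₂ :+ :- (s :* a₁)) := w :* r₁ :+ a₂ :+ :- (s :* (w :* r₀ :+ a₁)))
      refl w s (reversed a w (suc n)) (reversed a w n) (a (suc (suc n))) (a (suc n)))

  reversed-root : ∀ {ss w n} → w ∈ ss → length ss ≤ n → reversed (vieta ss) w n ≡ 0#
  reversed-root {s ∷ ss} {w} {suc n} w∈ (s≤s ≤n) = begin
    reversed (vieta (s ∷ ss)) w (suc n)                      ≡⟨ reversed-times s (vieta ss) w n ⟩
    w * r + vieta ss (suc n) + - (s * r)
      -- Only this coefficient obstructs splitting off the factor w - s; it vanishes as its index
      -- exceeds the number of remaining elements.
      ≡⟨ cong (λ x → w * r + x + - (s * r)) (vieta-vanishes ss (s≤s ≤n)) ⟩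
    w * r + 0# + - (s * r)                                   ≡⟨ cong (_+ - (s * r)) (+-identityʳ _) ⟩
    w * r + - (s * r)
      ≡⟨ solve 3 (λ w s r → w :* r :+ :- (s :* r) := (w :+ :- s) :* r) refl w s r ⟩
    (w + - s) * r                                            ≡⟨ factor w∈ ⟩
    0#                                                       ∎
    where
    r = reversed (vieta ss) w n
    factor : w ∈ s ∷ ss → (w + - s) * r ≡ 0#
    factor (here refl) = trans (cong (_* r) (-‿inverseʳ w)) (zeroˡ r)
    factor (there w∈ss) = trans (*-congˡ (reversed-root w∈ss ≤n)) (zeroʳ _)

  -- The exponents of c run from j + 1 to j + n, all within reach of `power-sum`. The weight c^j is
  -- there for the induction: each unfolding of `conv` moves one factor c into it. The application
  -- has j = 0.
  sumAll-conv : ∀ a j n → suc (j ℕ.+ n) < q → sumAll (λ c → c ^ j * conv c a n) ≡ 0#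
  sumAll-conv a j zero    <q = trans (sum-cong-≗ {q} {y = λ _ → 0#} (λ i → zeroʳ _)) (sum-zero {q} (λ _ → 0#) λ _ → refl)
  sumAll-conv a j (suc n) <q = begin
    sumAll (λ c → c ^ j * (c * (a n + conv c a n)))
      ≡⟨ sum-cong-≗ {q} {x = (λ c → c ^ j * (c * (a n + conv c a n))) ∘ from}
                    {y = λ i → a n * from i ^ suc j + from i ^ suc j * conv (from i) a n}
           (λ i → solve 4 (λ c x a y → x :* (c :* (a :+ y)) := a :* (c :* x) :+ c :* x :* y)
                refl (from i) (from i ^ j) (a n) (conv (from i) a n)) ⟩
    sumAll (λ c → a n * c ^ suc j + c ^ suc j * conv c a n)
      ≡⟨ ∑-distrib-+ (λ i → a n * from i ^ suc j) (λ i → from i ^ suc j * conv (from i) a n) ⟩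
    sumAll (λ c → a n * c ^ suc j) + sumAll (λ c → c ^ suc j * conv c a n)
      ≡⟨ cong₂ _+_ (sym (*-distribˡ-sum (a n) (λ i → from i ^ suc j))) (sumAll-conv a (suc j) n (subst (λ k → suc k < q) (ℕₚ.+-suc j n) <q)) ⟩
    a n * sumAll (_^ suc j) + 0#
      ≡⟨ trans (+-identityʳ _) (*-congˡ (power-sum j (ℕₚ.≤-<-trans (s≤s (subst (suc j ≤_) (sym (ℕₚ.+-suc j n)) (ℕₚ.m≤m+n (suc j) n))) <q))) ⟩
    a n * 0#
      ≡⟨ zeroʳ (a n) ⟩
    0# ∎
    where
    from : Fin q → Carrier
    from = Inverse.from enumeration

-- Pencils of parallel lines

module Pencils {q : ℕ} (F : FiniteField q) where
  open FiniteField F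
  open Plane F
  open Field F
  open CommutativeRing commutativeRing using
    (*-assoc; *-identityʳ; zeroˡ; zeroʳ; +-identityˡ; +-identityʳ; +-congˡ; -‿inverseʳ;
     +-abelianGroup)
  open IntegerScalars commutativeRing using (module Solver)
  open Solver using (solve; _:=_; _:+_; _:*_; :-_)
  open ≡-Reasoning

  ∼-sym : ∀ {ℓ ℓ′} → ℓ ∼ ℓ′ → ℓ′ ∼ ℓ
  ∼-sym (c , c≢0 , u≡ , v≡ , w≡) with z , cz≡1 ← inverse c c≢0 =
    z , (λ { refl → 1#≢0# (trans (sym cz≡1) (zeroʳ c)) }) , cancel u≡ , cancel v≡ , cancel w≡
    where
    cancel : ∀ {x y} → x ≡ c * y → y ≡ z * x
    cancel {x} {y} x≡cy = begin
      y            ≡⟨ *-identityʳ y ⟨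
      y * 1#       ≡⟨ cong (y *_) cz≡1 ⟨
      y * (c * z)  ≡⟨ solve 3 (λ y c z → y :* (c :* z) := z :* (c :* y)) refl y c z ⟩
      z * (c * y)  ≡⟨ cong (z *_) x≡cy ⟨
      z * x        ∎

  ∼-trans : ∀ {ℓ ℓ′ ℓ″} → ℓ ∼ ℓ′ → ℓ′ ∼ ℓ″ → ℓ ∼ ℓ″
  ∼-trans (c , c≢0 , refl , refl , refl) (d , d≢0 , refl , refl , refl) =
    c * d , *-nonzero c≢0 d≢0 , sym (*-assoc c d _) , sym (*-assoc c d _) , sym (*-assoc c d _)

  ⟨⟩-resp-∼ : ∀ {ℓ ℓ′} P → ℓ ∼ ℓ′ → ⟨ ℓ′ , P ⟩ ≡ 0# → ⟨ ℓ , P ⟩ ≡ 0#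
  ⟨⟩-resp-∼ {_} {u , v , w} (x , y , z) (c , _ , refl , refl , refl) eq = begin
    c * u * x + c * v * y + c * w * z
      ≡⟨ solve 7 (λ c u v w x y z → c :* u :* x :+ c :* v :* y :+ c :* w :* z := c :* (u :* x :+ v :* y :+ w :* z))
           refl c u v w x y z ⟩
    c * (u * x + v * y + w * z)         ≡⟨ cong (c *_) eq ⟩
    c * 0#                              ≡⟨ zeroʳ c ⟩
    0#                                  ∎

  ∩-resp-∼ : ∀ {ℓ ℓ′} T → ℓ ∼ ℓ′ → ∣ ℓ ∩ T ∣ ≡ ∣ ℓ′ ∩ T ∣
  ∩-resp-∼ {ℓ} {ℓ′} T ℓ∼ℓ′ = cong length (Listₚ.filter-≐
    (λ P → ⟨ ℓ , affine P ⟩ ≟ 0#) (λ P → ⟨ ℓ′ , affine P ⟩ ≟ 0#)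
    ((λ {P} → ⟨⟩-resp-∼ (affine P) (∼-sym ℓ∼ℓ′)) , (λ {P} → ⟨⟩-resp-∼ (affine P) ℓ∼ℓ′)) T)

  module _ {d : Direction} {u v w : Carrier} (line : AffineLineWithSlope d (u , v , w)) where
    open AffineLineWithSlope line

    normal≢0 : u ≡ 0# → v ≡ 0# → ⊥
    normal≢0 u≡0 v≡0 with w ≟ 0#
    ... | yes w≡0 = nonzero (cong₂ _,_ u≡0 (cong₂ _,_ v≡0 w≡0))
    ... | no  w≢0 = ≁ℓ∞ (w , w≢0 , trans u≡0 (sym (zeroʳ w)) , trans v≡0 (sym (zeroʳ w)) , sym (*-identityʳ w))

    parallel : ∀ c → AffineLineWithSlope d (u , v , c)
    parallel c = record
      { nonzero = λ eq → normal≢0 (cong proj₁ eq) (cong (proj₁ ∘ proj₂) eq)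
      ; ≁ℓ∞ = λ { (e , _ , u≡ , v≡ , _) → normal≢0 (trans u≡ (zeroʳ e)) (trans v≡ (zeroʳ e)) }
      ; through = trans (moved d) through
      }
      where
      moved : ∀ d → ⟨ (u , v , c) , atInfinity d ⟩ ≡ ⟨ (u , v , w) , atInfinity d ⟩
      moved ⦅ _ ⦆ = +-congˡ (trans (zeroʳ c) (sym (zeroʳ w)))
      moved ⦅∞⦆   = +-congˡ (trans (zeroʳ c) (sym (zeroʳ w)))

  slope-finite : ∀ {d u v w} → AffineLineWithSlope ⦅ d ⦆ (u , v , w) → u ≡ - (v * d)
  slope-finite {d} {u} {v} {w} line = begin
    u                                          ≡⟨ *-identityʳ u ⟨
    u * 1#
      ≡⟨ solve 3 (λ x y z → x := x :+ y :+ z :+ :- y :+ :- z) refl (u * 1#) (v * d) (w * 0#) ⟩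
    u * 1# + v * d + w * 0# + - (v * d) + - (w * 0#)
      ≡⟨ cong₂ (λ x y → x + - (v * d) + - y) (AffineLineWithSlope.through line) (zeroʳ w) ⟩
    0# + - (v * d) + - 0#                      ≡⟨ solve 2 (λ z y → z :+ y :+ :- z := y) refl 0# (- (v * d)) ⟩
    - (v * d)                                  ∎

  slope-infinite : ∀ {u v w} → AffineLineWithSlope ⦅∞⦆ (u , v , w) → v ≡ 0#
  slope-infinite {u} {v} {w} line = begin
    v                                ≡⟨ *-identityʳ v ⟨
    v * 1#                           ≡⟨ +-identityˡ _ ⟨
    0# + v * 1#                      ≡⟨ +-identityʳ _ ⟨
    0# + v * 1# + 0#                 ≡⟨ cong₂ (λ x y → x + v * 1# + y) (zeroʳ u) (zeroʳ w) ⟨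
    u * 0# + v * 1# + w * 0#         ≡⟨ AffineLineWithSlope.through line ⟩
    0#                               ∎

  -- With u, v fixed, the lines of the pencil are thus parametrised by the third coordinate alone.
  -- The scaling factor is v/v′ at a finite direction and u/u′ at (∞): there these coordinates
  -- cannot vanish, as the normal would be zero.
  same-normal : ∀ d {u v w ℓ′} → AffineLineWithSlope d (u , v , w) → AffineLineWithSlope d ℓ′ →
                ∃[ c ] (u , v , c) ∼ ℓ′
  same-normal ⦅ d ⦆ {u} {v} {w} {u′ , v′ , w′} line line′ = e * w′ , e , *-nonzero v≢0 z≢0 , u≡ , v≡ , refl
    where
    vanishes : ∀ {u v w} → AffineLineWithSlope ⦅ d ⦆ (u , v , w) → v ≢ 0#
    vanishes line refl = normal≢0 line (trans (slope-finite line) (trans (cong -_ (zeroˡ d)) (trans (sym (+-identityˡ _)) (-‿inverseʳ 0#)))) refl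
    v≢0  = vanishes line
    v′≢0 = vanishes line′
    z : Carrier
    z = proj₁ (inverse v′ v′≢0)
    v′z≡1 : v′ * z ≡ 1#
    v′z≡1 = proj₂ (inverse v′ v′≢0)
    z≢0 : z ≢ 0#
    z≢0 z≡0 = 1#≢0# (trans (sym v′z≡1) (trans (cong (v′ *_) z≡0) (zeroʳ v′)))
    e = v * z
    v≡ : v ≡ e * v′
    v≡ = begin
      v              ≡⟨ *-identityʳ v ⟨
      v * 1#         ≡⟨ cong (v *_) v′z≡1 ⟨
      v * (v′ * z)   ≡⟨ solve 3 (λ v v′ z → v :* (v′ :* z) := v :* z :* v′) refl v v′ z ⟩
      v * z * v′     ∎
    u≡ : u ≡ e * u′
    u≡ = begin
      u                  ≡⟨ slope-finite line ⟩
      - (v * d)          ≡⟨ cong (λ x → - (x * d)) v≡ ⟩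
      - (e * v′ * d)     ≡⟨ solve 3 (λ e v′ d → :- (e :* v′ :* d) := e :* :- (v′ :* d)) refl e v′ d ⟩
      e * - (v′ * d)     ≡⟨ cong (e *_) (slope-finite line′) ⟨
      e * u′             ∎
  same-normal ⦅∞⦆ {u} {v} {w} {u′ , v′ , w′} line line′ = e * w′ , e , *-nonzero u≢0 z≢0 , u≡ , v≡ , refl
    where
    vanishes : ∀ {u v w} → AffineLineWithSlope ⦅∞⦆ (u , v , w) → u ≢ 0#
    vanishes line refl = normal≢0 line refl (slope-infinite line)
    u≢0  = vanishes line
    u′≢0 = vanishes line′
    z : Carrier
    z = proj₁ (inverse u′ u′≢0)
    u′z≡1 : u′ * z ≡ 1#
    u′z≡1 = proj₂ (inverse u′ u′≢0)
    z≢0 : z ≢ 0#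
    z≢0 z≡0 = 1#≢0# (trans (sym u′z≡1) (trans (cong (u′ *_) z≡0) (zeroʳ u′)))
    e = u * z
    u≡ : u ≡ e * u′
    u≡ = begin
      u              ≡⟨ *-identityʳ u ⟨
      u * 1#         ≡⟨ cong (u *_) u′z≡1 ⟨
      u * (u′ * z)   ≡⟨ solve 3 (λ v v′ z → v :* (v′ :* z) := v :* z :* v′) refl u u′ z ⟩
      u * z * u′     ∎
    v≡ : v ≡ e * v′
    v≡ = trans (slope-infinite line) (sym (trans (cong (e *_) (slope-infinite line′)) (zeroʳ e)))

-- Meant for lines a and third coordinates b, with `▷` for "represents": a coordinate determines its
-- line, so distinct lines get distinct coordinates.
reduce-unique : {A B : Set} {_≈_ : A → A → Set} {_▷_ : B → A → Set} {Q : B → Set} →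
                (∀ {b a a′} → b ▷ a → b ▷ a′ → a ≈ a′) →
                ∀ {as} → AllPairs (λ a a′ → ¬ (a ≈ a′)) as → (r : All (λ a → ∃[ b ] b ▷ a × Q b) as) →
                Unique (All.reduce proj₁ r) × All Q (All.reduce proj₁ r) × length (All.reduce proj₁ r) ≡ length as
reduce-unique functional [] [] = [] , [] , refl
reduce-unique {_≈_ = _≈_} {_▷_} {Q} functional (a≉as ∷ as≉) ((b , b▷a , Qb) ∷ r)
  with uniq , Qbs , len ← reduce-unique {_≈_ = _≈_} {_▷_} {Q} functional as≉ r =
  fresh a≉as r ∷ uniq , Qb ∷ Qbs , cong suc len
  where
  fresh : ∀ {as} → All (λ a′ → ¬ (_ ≈ a′)) as → (r : All (λ a → ∃[ b ] b ▷ a × Q b) as) → All (b ≢_) (All.reduce proj₁ r)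
  fresh []           []                      = []
  fresh (a≉a′ ∷ a≉) ((b′ , b′▷a′ , _) ∷ r) = (λ { refl → a≉a′ (functional b▷a b′▷a′) }) ∷ fresh a≉ r

-- The envelope, built from T and κ

module Envelope {q : ℕ} (F : FiniteField q) (T : Plane.Multiset F) (κ : FiniteField.Carrier F) where
  open FiniteField F
  open Plane F
  open Field F
  open Forms F
  open Newton F
  open Pencils F
  open CommutativeRing commutativeRing using
    (+-commutativeMonoid; +-abelianGroup; +-identityˡ; +-identityʳ; +-congˡ; *-congˡ; -‿inverseʳ;
     zeroˡ; zeroʳ; distribʳ; *-assoc; *-identityʳ; *-identityˡ)
  open Algebra.Properties.AbelianGroup +-abelianGroup using (inverseʳ-unique)
  open Algebra.Properties.Semiring.Mult semiring using () renaming (_×_ to _·_)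
  open Algebra.Properties.Semiring.Sum semiring using (sum-cong-≗)
  open Algebra.Properties.CommutativeMonoid.Sum +-commutativeMonoid using (∑-distrib-+)
  open IntegerScalars commutativeRing using (module Solver)
  open Solver using (solve; _:=_; _:+_; _:*_; :-_)
  open ≡-Reasoning

  -- The value 0 at 0 makes `coefficient` total; the comparison with `vieta` stops at index λ < p,
  -- where the arguments are nonzero.
  recip : Carrier → Carrier
  recip x with x ≟ 0#
  ... | yes _   = 0#
  ... | no  x≢0 = proj₁ (inverse x x≢0)

  *-recip : ∀ {x} → x ≢ 0# → x * recip x ≡ 1#
  *-recip {x} x≢0 with x ≟ 0#
  ... | yes x≡0 = ⊥-elim (x≢0 x≡0)
  ... | no  x≢0 = proj₂ (inverse x x≢0)

  intercept : Triple → AffinePoint → Carrier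
  intercept (u , v , _) (a , b) = - (u * a + v * b)

  -- Newton's identities solved for the coefficients; κ stands for 1/δ.
  coefficient : ℕ → Triple → Carrier
  pointConv   : AffinePoint → ℕ → Triple → Carrier

  coefficient zero    ℓ = 1#
  coefficient (suc n) ℓ = - (recip (suc n · 1#)) * (κ * sumOver T (λ P → pointConv P (suc n) ℓ))

  pointConv P zero    ℓ = 0#
  pointConv P (suc n) ℓ = intercept ℓ P * (coefficient n ℓ + pointConv P n ℓ)

  form-*intercept : ∀ {n f} P → IsForm n f → IsForm (suc n) (λ ℓ → intercept ℓ P * f ℓ)
  form-*intercept {f = f} (a , b) form = form-cong
    (λ { ℓ@(u , v , w) → solve 5 (λ a b u v f → :- a :* (u :* f) :+ :- b :* (v :* f) := :- (u :* a :+ v :* b) :* f)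
         refl a b u v (f ℓ) })
    (form-+ (form-scale (- a) (form-*U form)) (form-scale (- b) (form-*V form)))

  coefficient-form : ∀ n → IsForm n (coefficient n)
  pointConv-form   : ∀ P n → IsForm n (pointConv P n)

  coefficient-form zero    = form-const 1#
  coefficient-form (suc n) = form-scale _ (form-scale κ (form-sumOver T λ P → pointConv-form P (suc n)))

  pointConv-form P zero    = form-const 0#
  pointConv-form P (suc n) = form-*intercept P (form-+ (coefficient-form n) (pointConv-form P n))

  value : ℕ → Triple → Carrier
  value n ℓ = reversed (λ i → coefficient i ℓ) (proj₂ (proj₂ ℓ)) n

  value-form : ∀ n → IsForm n (value n)
  value-form zero    = form-const 1#
  value-form (suc n) = form-+ (form-*W (value-form n)) (coefficient-form (suc n))

  -- At u = v = 0 every intercept is zero and only Wⁿ survives. This shows that the envelope is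
  -- nonzero for every T and κ.
  value-ℓ∞ : ∀ n → value n ℓ∞ ≡ 1#
  value-ℓ∞ zero    = refl
  value-ℓ∞ (suc n) = begin
    1# * value n ℓ∞ + coefficient (suc n) ℓ∞   ≡⟨ cong₂ _+_ (trans (*-identityˡ _) (value-ℓ∞ n)) vanish ⟩
    1# + 0#                                    ≡⟨ +-identityʳ 1# ⟩
    1#                                         ∎
    where
    pointConv≡0 : ∀ P → pointConv P (suc n) ℓ∞ ≡ 0#
    pointConv≡0 P@(a , b) = trans (solve 4 (λ z a b y → :- (z :* a :+ z :* b) :* y := z :* (:- (a :+ b) :* y))
         refl 0# a b (coefficient n ℓ∞ + pointConv P n ℓ∞)) (zeroˡ _)
    vanish : coefficient (suc n) ℓ∞ ≡ 0#
    vanish = trans (*-congˡ (trans (*-congˡ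
      (sum-zero {length T} (λ i → pointConv (lookup T i) (suc n) ℓ∞) λ i → pointConv≡0 (lookup T i))) (zeroʳ κ))) (zeroʳ _)

  envelope : ∀ n → AlgebraicEnvelope n
  envelope n = record
    { polynomial = proj₁ (value-form n)
    ; nonzero    = form-nonzero (value-form n) (λ eq → 1#≢0# (trans (sym (value-ℓ∞ n)) eq))
    }

  incident⇔ : ∀ u v c P →
              (⟨ (u , v , c) , affine P ⟩ ≡ 0# → c ≡ intercept (u , v , c) P) ×
              (c ≡ intercept (u , v , c) P → ⟨ (u , v , c) , affine P ⟩ ≡ 0#)
  incident⇔ u v c (a , b) =
    (λ eq → inverseʳ-unique _ c (trans (+-congˡ (sym (*-identityʳ c))) eq)) ,
    (λ c≡ → trans (+-congˡ (trans (*-identityʳ c) c≡)) (-‿inverseʳ _))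

  -- Double counting: each point lies on exactly one line [u : v : c], and the points are grouped by
  -- that c.
  sumOver-intercept : ∀ S u v w (φ : Carrier → Carrier) →
                      sumOver S (λ P → φ (intercept (u , v , w) P)) ≡
                      sumAll (λ c → ∣ (u , v , c) ∩ S ∣ · 1# * φ c)
  sumOver-intercept []      u v w φ = sym (sum-zero {q} (λ i → 0# * φ (from i)) λ i → zeroˡ _)
    where from = Inverse.from enumeration
  sumOver-intercept (P ∷ S) u v w φ = sym (begin
    sumAll (λ c → ∣ (u , v , c) ∩ P ∷ S ∣ · 1# * φ c)
      ≡⟨ sum-cong-≗ {q} {y = λ i → 𝟙 (on? (from i)) * φ (from i) + ∣ (u , v , from i) ∩ S ∣ · 1# * φ (from i)}
           (λ i → trans (cong (_* φ (from i)) (length-filter-∷ (λ P → ⟨ (u , v , from i) , affine P ⟩ ≟ 0#) P S)) (distribʳ _ _ _)) ⟩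
    sumAll (λ c → 𝟙 (on? c) * φ c + ∣ (u , v , c) ∩ S ∣ · 1# * φ c)
      ≡⟨ ∑-distrib-+ (λ i → 𝟙 (on? (from i)) * φ (from i)) (λ i → ∣ (u , v , from i) ∩ S ∣ · 1# * φ (from i)) ⟩
    sumAll (λ c → 𝟙 (on? c) * φ c) + sumAll (λ c → ∣ (u , v , c) ∩ S ∣ · 1# * φ c)
      ≡⟨ cong₂ _+_
           (sumAll-𝟙 on? φ (intercept (u , v , w) P) (proj₂ (incident⇔ u v _ P) refl) (λ c → proj₁ (incident⇔ u v c P)))
           (sym (sumOver-intercept S u v w φ)) ⟩
    φ (intercept (u , v , w) P) + sumOver S (λ P → φ (intercept (u , v , w) P)) ∎)
    where
    from = Inverse.from enumeration
    on? : ∀ c → Dec (⟨ (u , v , c) , affine P ⟩ ≡ 0#)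
    on? c = ⟨ (u , v , c) , affine P ⟩ ≟ 0#

  -- Comparison within one pencil

  module Coefficients
    {p k : ℕ} (p-prime : Prime p) (q≡p^k : q ≡ p ℕ.^ k)
    {lam : ℕ} (lam<p : lam < p) (lam+1<q : suc lam < q)
    {u v : Carrier} {μ δ : Carrier} (κδ≡1 : κ * δ ≡ 1#)
    {S : Carrier → Set} (S? : ∀ c → Dec (S c))
    (count : ∀ c → ∣ (u , v , c) ∩ T ∣ · 1# ≡ μ + δ * 𝟙 (S? c))
    (w : Carrier)
    where
    open Characteristic {k = k} p-prime q≡p^k

    ss : List Carrier
    ss = filter S? elements

    ℓ : Triple
    ℓ = u , v , w

    -- The common part μ of the intersection numbers contributes μ Σφ = 0; what remains is δ times
    -- the sum over the marked values, and κ cancels δ.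
    sumOver-T : ∀ (φ : Carrier → Carrier) → sumAll φ ≡ 0# → κ * sumOver T (λ P → φ (intercept ℓ P)) ≡ sumOver ss φ
    sumOver-T φ Σφ≡0 = begin
      κ * sumOver T (λ P → φ (intercept ℓ P))
        ≡⟨ cong (κ *_) (sumOver-intercept T u v w φ) ⟩
      κ * sumAll (λ c → ∣ (u , v , c) ∩ T ∣ · 1# * φ c)
        ≡⟨ cong (κ *_) (sum-cong-≗ {q} {y = λ i → μ * φ (from i) + δ * (𝟙 (S? (from i)) * φ (from i))} λ i →
             trans (cong (_* φ (from i)) (count (from i)))
               (solve 4 (λ μ δ s f → (μ :+ δ :* s) :* f := μ :* f :+ δ :* (s :* f))
                    refl μ δ (𝟙 (S? (from i))) (φ (from i)))) ⟩
      κ * sumAll (λ c → μ * φ c + δ * (𝟙 (S? c) * φ c))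
        ≡⟨ cong (κ *_) (sum-linear (λ i → φ (from i)) (λ i → 𝟙 (S? (from i)) * φ (from i)) μ δ) ⟩
      κ * (μ * sumAll φ + δ * sumAll (λ c → 𝟙 (S? c) * φ c))
        ≡⟨ cong (λ x → κ * (μ * x + δ * Σs)) Σφ≡0 ⟩
      κ * (μ * 0# + δ * Σs)
        ≡⟨ cong (λ x → κ * (x + δ * Σs)) (zeroʳ μ) ⟩
      κ * (0# + δ * Σs)
        ≡⟨ cong (κ *_) (+-identityˡ _) ⟩
      κ * (δ * Σs)
        ≡⟨ *-assoc κ δ _ ⟨
      κ * δ * Σs
        ≡⟨ trans (cong (_* Σs) κδ≡1) (*-identityˡ _) ⟩
      Σs
        ≡⟨ sumOver-tabulate from (λ c → 𝟙 (S? c) * φ c) ⟨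
      sumOver elements (λ c → 𝟙 (S? c) * φ c)
        ≡⟨ sumOver-filter S? elements φ ⟨
      sumOver ss φ ∎
      where
      from = Inverse.from enumeration
      Σs = sumAll (λ c → 𝟙 (S? c) * φ c)

    -- Both sides obey Newton's recursion. The bound by λ gives the vanishing sums (λ ≤ q - 2) and
    -- the invertible n + 1 (λ < p). `pointConv` of index n only uses coefficients of smaller index,
    -- so its bound is one larger.
    coefficient≡vieta : ∀ n → n ≤ lam → coefficient n ℓ ≡ vieta ss n
    pointConv≡conv    : ∀ P n → n ≤ suc lam → pointConv P n ℓ ≡ conv (intercept ℓ P) (vieta ss) n

    coefficient≡vieta zero    _   = sym (vieta-0 ss)
      where
      vieta-0 : ∀ ss → vieta ss 0 ≡ 1#
      vieta-0 []       = refl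
      vieta-0 (_ ∷ ss) = vieta-0 ss
    coefficient≡vieta (suc n) n<lam = begin
      - r * (κ * sumOver T (λ P → pointConv P (suc n) ℓ))
        ≡⟨ cong (λ x → - r * (κ * x)) (sum-cong-≗ {length T} (λ i → pointConv≡conv (lookup T i) (suc n) (ℕₚ.m≤n⇒m≤1+n n<lam))) ⟩
      - r * (κ * sumOver T (λ P → conv (intercept ℓ P) a (suc n)))
        ≡⟨ cong (- r *_) (sumOver-T (λ c → conv c a (suc n)) Σconv≡0) ⟩
      - r * X
        -- Completes X to the left side of Newton's identity, which is zero; the compensating term
        -- has factor νr = 1.
        ≡⟨ solve 4 (λ r X ν x → :- r :* X := :- r :* (ν :* x :+ X) :+ ν :* r :* x) refl r X ν (a (suc n)) ⟩
      - r * (ν * a (suc n) + X) + ν * r * a (suc n)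
        ≡⟨ cong₂ (λ x y → - r * x + y * a (suc n)) (newton ss (suc n)) (*-recip (·1≢0 (ℕₚ.≤-<-trans n<lam lam<p))) ⟩
      - r * 0# + 1# * a (suc n)
        ≡⟨ cong₂ _+_ (zeroʳ (- r)) (*-identityˡ _) ⟩
      0# + a (suc n)
        ≡⟨ +-identityˡ _ ⟩
      a (suc n) ∎
      where
      ν = suc n · 1#
      r = recip ν
      a = vieta ss
      X = sumOver ss (λ c → conv c a (suc n))
      Σconv≡0 : sumAll (λ c → conv c a (suc n)) ≡ 0#
      Σconv≡0 = trans (sum-cong-≗ {q} (λ i → sym (*-identityˡ _))) (sumAll-conv a 0 (suc n) (ℕₚ.≤-<-trans (s≤s n<lam) lam+1<q))

    pointConv≡conv P zero    _         = refl
    pointConv≡conv P (suc n) (s≤s n≤lam) = cong₂ (λ x y → intercept ℓ P * (x + y)) (coefficient≡vieta n n≤lam) (pointConv≡conv P n (ℕₚ.m≤n⇒m≤1+n n≤lam))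

    ∈envelope : w ∈ ss → length ss ≤ lam → ℓ ∈ᵉ envelope lam
    ∈envelope w∈ss ss≤lam = begin
      eval (proj₁ (value-form lam)) ℓ    ≡⟨ proj₂ (value-form lam) ℓ ⟩
      value lam ℓ                        ≡⟨ reversed-cong w lam (λ {i} → coefficient≡vieta i) ⟩
      reversed (vieta ss) w lam          ≡⟨ reversed-root w∈ss ss≤lam ⟩
      0#                                 ∎

-- From uniform directions to the envelope

module RenitentLines {q : ℕ} (F : FiniteField q) (T : Plane.Multiset F)
  {p k : ℕ} (p-prime : Prime p) (q≡p^k : q ≡ p ℕ.^ k)
  {lam : ℕ} (lam<p : lam < p) (lam+1<q : suc lam < q)
  where
  open FiniteField F
  open Plane F
  open Field F
  open Characteristic {k = k} p-prime q≡p^k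
  open Pencils F
  open CommutativeRing commutativeRing using (+-identityʳ; +-congˡ; zeroʳ; *-identityʳ)
  open Algebra.Properties.Semiring.Mult semiring using () renaming (_×_ to _·_)
  open IntegerScalars commutativeRing using (ι; ι--; module Solver)
  open Solver using (solve; _:=_; _:+_; :-_)
  open ≡-Reasoning

  atypical? : ∀ u v m c → Dec (∣ (u , v , c) ∩ T ∣ · 1# ≢ ι m)
  atypical? u v m c = ¬? (∣ (u , v , c) ∩ T ∣ · 1# ≟ ι m)

  -- The at least q - λ typical lines yield as many distinct coordinates c, disjoint from the
  -- atypical ones, and F has only q elements.
  number-of-atypical : ∀ {d u v w m} → AffineLineWithSlope d (u , v , w) → Typical p T lam d m →
                       length (filter (atypical? u v m) elements) ≤ lam
  number-of-atypical {d} {u} {v} {w} {m} line (ℓs , q∸lam≤ , distinct , typical) =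
    subst (length ss ≤_) (ℕₚ.m∸[m∸n]≡n (ℕₚ.<⇒≤ (ℕₚ.<-trans (ℕₚ.n<1+n lam) lam+1<q)))
      (ℕₚ.m+n≤o⇒m≤o∸n (length ss) (ℕₚ.≤-trans
        (ℕₚ.+-monoʳ-≤ (length ss) (subst (q ∸ lam ≤_) (sym length-cs) q∸lam≤))
        (subst (_≤ q) (Listₚ.length-++ ss) (length-unique (Uniqueₚ.++⁺ ss! cs! disjoint)))))
    where
    ss = filter (atypical? u v m) elements
    representative : ∀ {ℓ′} → AffineLineWithSlope d ℓ′ × ℤ.+ ∣ ℓ′ ∩ T ∣ ≡ m [mod p ] →
                     ∃[ c ] (u , v , c) ∼ ℓ′ × ∣ (u , v , c) ∩ T ∣ · 1# ≡ ι m
    representative {ℓ′} (line′ , ≡m) with c , c∼ ← same-normal d line line′ =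
      c , c∼ , trans (cong (_· 1#) (∩-resp-∼ T c∼)) (mod⇒ι (ℤ.+ ∣ ℓ′ ∩ T ∣) m ≡m)
    ss! : Unique ss
    ss! = Uniqueₚ.filter⁺ (atypical? u v m) elements-unique
    representatives = All.map representative typical
    cs = All.reduce proj₁ representatives
    cs-properties : Unique cs × All (λ c → ∣ (u , v , c) ∩ T ∣ · 1# ≡ ι m) cs × length cs ≡ length ℓs
    cs-properties = reduce-unique {_▷_ = λ c ℓ → (u , v , c) ∼ ℓ} (λ x y → ∼-trans (∼-sym x) y) distinct representatives
    cs! = proj₁ cs-properties
    cs-typical = proj₁ (proj₂ cs-properties)
    length-cs = proj₂ (proj₂ cs-properties)
    disjoint : ∀ {c} → c ∈ ss × c ∈ cs → ⊥
    disjoint (c∈ss , c∈cs) = proj₂ (∈-filter⁻ (atypical? u v m) {xs = elements} c∈ss) (All.lookup cs-typical c∈cs)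

  renitent∈envelope : ∀ {d κ} m t → κ * ι (t ℤ.- m) ≡ 1# → Typical p T lam d m →
                      (∀ ℓ → Renitent p T d m ℓ → ℤ.+ ∣ ℓ ∩ T ∣ ≡ t [mod p ]) →
                      ∀ ℓ → Renitent p T d m ℓ → ℓ ∈ᵉ Envelope.envelope F T κ lam
  renitent∈envelope {d} {κ} m t κδ≡1 typical constant (u , v , w) (line , ≢m) =
    Envelope.Coefficients.∈envelope F T κ {k = k} p-prime q≡p^k lam<p lam+1<q {u = u} {v = v} κδ≡1 (atypical? u v m) count w
      (∈-filter⁺ (atypical? u v m) (subst (_∈ elements) (strictlyInverseʳ w) (∈-tabulate⁺ (to w)))
        (λ eq → ≢m (ι⇒mod (ℤ.+ ∣ (u , v , w) ∩ T ∣) m eq)))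
      (number-of-atypical {m = m} line typical)
    where
    open Inverse enumeration using (to; strictlyInverseʳ)
    -- Here μ = m and δ = t - m in F: a line of the pencil that misses the value m is renitent, and
    -- (ii) forces the value t on it.
    count : ∀ c → ∣ (u , v , c) ∩ T ∣ · 1# ≡ ι m + ι (t ℤ.- m) * 𝟙 (atypical? u v m c)
    count c = cases (∣ (u , v , c) ∩ T ∣ · 1# ≟ ι m)
      where
      δ = ι (t ℤ.- m)
      cases : Dec (∣ (u , v , c) ∩ T ∣ · 1# ≡ ι m) → ∣ (u , v , c) ∩ T ∣ · 1# ≡ ι m + δ * 𝟙 (atypical? u v m c)
      cases (yes ≡m) = begin
        ∣ (u , v , c) ∩ T ∣ · 1#            ≡⟨ ≡m ⟩
        ι m                                 ≡⟨ +-identityʳ _ ⟨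
        ι m + 0#                            ≡⟨ +-congˡ (zeroʳ δ) ⟨
        ι m + δ * 0#                        ≡⟨ cong (λ x → ι m + δ * x) (𝟙-no (atypical? u v m c) (λ ≢m → ≢m ≡m)) ⟨
        ι m + δ * 𝟙 (atypical? u v m c)     ∎
      cases (no ≢m) = begin
        ∣ (u , v , c) ∩ T ∣ · 1#
          ≡⟨ mod⇒ι (ℤ.+ ∣ (u , v , c) ∩ T ∣) t (constant (u , v , c)
               (parallel line c , λ eq → ≢m (mod⇒ι (ℤ.+ ∣ (u , v , c) ∩ T ∣) m eq))) ⟩
        ι t                                 ≡⟨ solve 2 (λ t m → t := m :+ (t :+ :- m)) refl (ι t) (ι m) ⟩
        ι m + (ι t + - ι m)                 ≡⟨ +-congˡ (ι-- t m) ⟨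
        ι m + δ                             ≡⟨ +-congˡ (*-identityʳ δ) ⟨
        ι m + δ * 1#                        ≡⟨ cong (λ x → ι m + δ * x) (𝟙-yes (atypical? u v m c) ≢m) ⟨
        ι m + δ * 𝟙 (atypical? u v m c)     ∎

  -- By (iii) the inverse of δ at the first direction serves for all of `E`. The equation is
  -- asserted only in the presence of a renitent line, which leaves room for δ = 0: then t_d ≡ m_d
  -- and no line is renitent.
  normalisation : ∀ (E : List Direction) (m t : Direction → ℤ) →
                  (∀ d → d ∈ E → ∀ ℓ → Renitent p T d (m d) ℓ → ℤ.+ ∣ ℓ ∩ T ∣ ≡ t d [mod p ]) →
                  (∀ d e → d ∈ E → e ∈ E → (t d ℤ.- m d) ≡ (t e ℤ.- m e) [mod p ]) →
                  ∃[ κ ] (∀ d → d ∈ E → ∀ ℓ → Renitent p T d (m d) ℓ → κ * ι (t d ℤ.- m d) ≡ 1#)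
  normalisation []        m t constant independent = 0# , λ _ ()
  normalisation E@(e ∷ _) m t constant independent with ι (t e ℤ.- m e) ≟ 0#
  ... | yes δ≡0 = 0# , λ d d∈E ℓ renitent → ⊥-elim (proj₂ renitent (ι⇒mod (ℤ.+ ∣ ℓ ∩ T ∣) (m d) (begin
      ι (ℤ.+ ∣ ℓ ∩ T ∣)              ≡⟨ mod⇒ι (ℤ.+ ∣ ℓ ∩ T ∣) (t d) (constant d d∈E ℓ renitent) ⟩
      ι (t d)                        ≡⟨ solve 2 (λ t m → t := m :+ (t :+ :- m)) refl (ι (t d)) (ι (m d)) ⟩
      ι (m d) + (ι (t d) + - ι (m d)) ≡⟨ +-congˡ (ι-- (t d) (m d)) ⟨
      ι (m d) + ι (t d ℤ.- m d)
        ≡⟨ +-congˡ (trans (mod⇒ι (t d ℤ.- m d) (t e ℤ.- m e) (independent d e d∈E (here refl))) δ≡0) ⟩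
      ι (m d) + 0#                   ≡⟨ +-identityʳ _ ⟩
      ι (m d)                        ∎)))
  ... | no  δ≢0 with κ , δκ≡1 ← inverse _ δ≢0 =
    κ , λ d d∈E _ _ → trans
      (cong (κ *_) (mod⇒ι (t d ℤ.- m d) (t e ℤ.- m e) (independent d e d∈E (here refl))))
      (trans (*-comm κ _) δκ≡1)
    where open CommutativeRing commutativeRing using (*-comm)

-- Since l > 0, the truncated difference is a true one. This turns (i) into λ < p and λ + 1 < q.
+≤⇐≤∸ : ∀ {l} k n → 0 < l → l ≤ n ∸ k → k ℕ.+ l ≤ n
+≤⇐≤∸ zero    n       0<l l≤n   = l≤n
+≤⇐≤∸ (suc k) zero    0<l l≤0   = ⊥-elim (ℕₚ.<⇒≱ 0<l l≤0)
+≤⇐≤∸ (suc k) (suc n) 0<l l≤n∸k = s≤s (+≤⇐≤∸ k n 0<l l≤n∸k)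

open import Data.Integer using (+_; _-_)
open import Data.Nat using (_⊓_; _^_)
open import Data.Product using (Σ-syntax)

theorem2p1 : (p k q : ℕ) → Prime p → 1 ≤ k → q ≡ p ^ k →
    (F : FiniteField q) →
    let open Plane F in
    (T : Multiset) (lam : ℕ) →
    (E : List Direction) → Unique E → length E ≤ q →
    (∀ d → d ∈ E → Uniform p T lam d) →
    (m : Direction → ℤ) → (∀ d → d ∈ E → Typical p T lam d (m d)) →
    0 < lam → lam ≤ (q ∸ 2) ⊓ (p ∸ 1) →
    (t : Direction → ℤ) →
    (∀ d → d ∈ E → ∀ ℓ → Renitent p T d (m d) ℓ → + ∣ ℓ ∩ T ∣ ≡ t d [mod p ]) →
    (∀ d e → d ∈ E → e ∈ E → (t d - m d) ≡ (t e - m e) [mod p ]) →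
    Σ[ 𝓔 ∈ AlgebraicEnvelope lam ] (∀ d → d ∈ E → ∀ ℓ → Renitent p T d (m d) ℓ → ℓ ∈ᵉ 𝓔)
theorem2p1 p k q p-prime _ q≡p^k F T lam E _ _ _ m typical 0<lam lam≤ t constant independent =
  Envelope.envelope F T κ lam ,
  λ d d∈E ℓ renitent → renitent∈envelope (m d) (t d) (κδ≡1 d d∈E ℓ renitent) (typical d d∈E) (constant d d∈E) ℓ renitent
  where
  open RenitentLines F T {k = k} p-prime q≡p^k
    (+≤⇐≤∸ 1 p 0<lam (ℕₚ.m≤n⊓o⇒m≤o (q ∸ 2) (p ∸ 1) lam≤))
    (+≤⇐≤∸ 2 q 0<lam (ℕₚ.m≤n⊓o⇒m≤n (q ∸ 2) (p ∸ 1) lam≤))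
  normalised = normalisation E m t constant independent
  κ = proj₁ normalised
  κδ≡1 = proj₂ normalised
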